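{- Let $p$ be a prime and $k,\ell$ integers with $k>0$, $\ell\ge0$; put $q=p^k$ and $Q=p^{\ell}$. Let $\Gamma$ be the set of roots in $\mathbb{F}_{q^3}$ of $X^{q^2}+X^q+X$. Then the polynomial $(X^q-X)\circ X^{Q+1}=X^{q(Q+1)}-X^{Q+1}$ permutes $\Gamma$ (i.e. maps $\Gamma$ bijectively onto $\Gamma$) if and only if $\gcd(q-1,Q+1)=1$, or equivalently, if and only if $p=2$ and $\operatorname{ord}_2(k)\le\operatorname{ord}_2(\ell)$.
   Context: For a nonzero integer $N$, $\operatorname{ord}_2(N)$ is the largest integer $s\ge0$ with $2^s\mid N$, and $\operatorname{ord}_2(0)=\infty$. -}

module Defs where

open import Algebra.Apartness.Bundles using (HeytingField; HeytingCommutativeRing)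
open import Algebra.Bundles using (CommutativeRing)
import Algebra.Properties.Semiring.Exp as Exp
open import Data.Fin.Base using (Fin)
open import Data.Nat.Base as ℕ using (ℕ; zero; suc; _≤_; z≤n; s≤s)
open import Data.Nat.Divisibility using (_∣_; _∣?_; 1∣_; ∣⇒≤)
import Data.Nat.Properties as ℕ
open import Data.Product.Base as Product using (Σ-syntax; ∃; _×_; _,_; proj₁)
open import Data.Sum.Base using (inj₁; inj₂)
open import Function.Base using (_∘_; _on_)
open import Function.Bundles using (Inverse)
open import Function.Definitions using (Bijective)
open import Level using (Level; 0ℓ; _⊔_)
open import Relation.Binary.Construct.Add.Supremum.NonStrict _≤_ using (_≤⁺_)
open import Relation.Binary.Core using (Rel)
import Relation.Binary.PropositionalEquality as ≡
open import Relation.Nullary.Construct.Add.Supremum using (_⁺; ⊤⁺; [_])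
open import Relation.Nullary.Decidable.Core using (yes; no)
open import Relation.Nullary.Negation.Core using (contradiction)
open import Relation.Unary using (Pred; Decidable)

private
  variable
    c ℓ₁ ℓ₂ s : Level

------------------------------------------------------------------------
-- The 2-adic order, with values in ℕ ∪ {∞}

-- The largest i ≤ b satisfying P, provided that P 0 holds.
largest : {P : Pred ℕ s} → Decidable P → ℕ → ℕ
largest P? zero    = zero
largest P? (suc b) with P? (suc b)
... | yes _ = suc b
... | no  _ = largest P? b

-- The search may stop at N, since 2 ^ i ∣ N and N ≠ 0 imply i ≤ N.
ord₂ : ℕ → ℕ ⁺
ord₂ zero      = ⊤⁺
ord₂ N@(suc _) = [ largest (λ i → 2 ℕ.^ i ∣? N) N ]

infix 4 _≤∞_

_≤∞_ : Rel (ℕ ⁺) 0ℓ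
_≤∞_ = _≤⁺_

largest-satisfies : {P : Pred ℕ s} (P? : Decidable P) → P 0 →
                    ∀ b → P (largest P? b)
largest-satisfies P? P0 zero    = P0
largest-satisfies P? P0 (suc b) with P? (suc b)
... | yes p = p
... | no  _ = largest-satisfies P? P0 b

largest-upper : {P : Pred ℕ s} (P? : Decidable P) →
                ∀ b {i} → i ≤ b → P i → i ≤ largest P? b
largest-upper P? zero    i≤b Pi = i≤b
largest-upper P? (suc b) i≤b Pi with P? (suc b)
... | yes _ = i≤b
... | no ¬p with ℕ.m≤n⇒m<n∨m≡n i≤b
...   | inj₁ (s≤s i≤b′) = largest-upper P? b i≤b′ Pi
...   | inj₂ ≡.refl     = contradiction Pi ¬p

n≤2^n : ∀ n → n ≤ 2 ℕ.^ n
n≤2^n zero    = z≤n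
n≤2^n (suc n) = ℕ.≤-trans (ℕ.+-mono-≤ (ℕ.m^n>0 2 n) (n≤2^n n))
                          (ℕ.+-monoʳ-≤ (2 ℕ.^ n) (ℕ.m≤m+n (2 ℕ.^ n) 0))

ord₂-spec : ∀ N .{{_ : ℕ.NonZero N}} →
            ∃ λ i → ord₂ N ≡.≡ [ i ] × 2 ℕ.^ i ∣ N × (∀ {j} → 2 ℕ.^ j ∣ N → j ≤ i)
ord₂-spec N@(suc _) = _ , ≡.refl ,
  largest-satisfies (λ i → 2 ℕ.^ i ∣? N) (1∣ N) N ,
  λ {j} 2^j∣N → largest-upper (λ i → 2 ℕ.^ i ∣? N) N
                  (ℕ.≤-trans (n≤2^n j) (∣⇒≤ 2^j∣N)) 2^j∣N

------------------------------------------------------------------------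
-- Finite fields

-- When the carrier is finite, invertibility is decidable, so x # y amounts
-- to ¬ (x ≈ y) and a Heyting field is the same as a field in the usual sense.
HasOrder : HeytingField c ℓ₁ ℓ₂ → ℕ → Set _
HasOrder F n = Inverse setoid (≡.setoid (Fin n))
  where open HeytingField F

module _ (F : HeytingField c ℓ₁ ℓ₂) where
  open HeytingField F
  open CommutativeRing (HeytingCommutativeRing.commutativeRing heytingCommutativeRing)
    using (semiring)
  open Exp semiring using (_^_; ^-assocʳ; ^-congʳ)

  Permutes : (Carrier → Carrier) → Pred Carrier s → Set (c ⊔ ℓ₁ ⊔ s)
  Permutes f S =
    Σ[ maps ∈ (∀ {x} → S x → S (f x)) ] Bijective _≈S_ _≈S_ (Product.map f maps)
    where
    _≈S_ : Rel (∃ S) ℓ₁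
    _≈S_ = _≈_ on proj₁

  Γ : ℕ → Pred Carrier ℓ₁
  Γ q x = x ^ (q ℕ.^ 2) + x ^ q + x ≈ 0#

  -- (X^q − X) ∘ X^(Q+1), as a function on F.
  f : ℕ → ℕ → Carrier → Carrier
  f q Q = (λ y → y ^ q - y) ∘ (λ x → x ^ (Q ℕ.+ 1))

  f-expanded : ∀ q Q x → f q Q x ≈ x ^ (q ℕ.* (Q ℕ.+ 1)) - x ^ (Q ℕ.+ 1)
  f-expanded q Q x =
    +-congʳ (trans (^-assocʳ x (Q ℕ.+ 1) q) (^-congʳ x (ℕ.*-comm (Q ℕ.+ 1) q)))

module Submission where

-- Write σ x = x^q and τ x = x^Q.  If ζ ≠ 1 satisfies ζ^(q-1) = ζ^(Q+1) = 1, then multiplication by ζ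
-- preserves Γ and does not change f, so f is not injective on Γ ≠ {0}.  Conversely, coprimality forces
-- p = 2, and it makes a ↦ a τ(a) injective on the fixed field of σ.  Suppose f(x) = f(x + h) with
-- x, h ∈ Γ and h ≠ 0; put u = σ h and D = h² + h u + u².  If D = 0, then σ acts on h as a cube root of
-- unity in the fixed field, and if D ≠ 0, then h and u are a basis of Γ over the fixed field; in
-- both cases the equation f(x) = f(x + h) yields a fixed point α of σ with τ(α) + α + 1 = 0.  Then
-- α τ(α) = (α + 1) τ(α + 1), which contradicts the injectivity.

open import Defs
open import Algebra.Apartness.Bundles using (HeytingField; HeytingCommutativeRing)
import Algebra.Apartness.Properties.HeytingCommutativeRing as HeytingProperties
open import Algebra.Bundles using (CommutativeMonoid; CommutativeRing; RawRing)
import Algebra.Properties.CommutativeMonoid.Sum as Sum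
import Algebra.Properties.CommutativeSemiring.Binomial as Binomial
import Algebra.Properties.CommutativeSemiring.Exp as Exp
import Algebra.Properties.Ring as RingProperties
import Algebra.Properties.Semiring.Mult as Mult
import Algebra.Solver.Ring as RingSolver
open import Algebra.Solver.Ring.AlmostCommutativeRing using (fromCommutativeRing; _-Raw-AlmostCommutative⟶_)
import Algebra.Solver.Ring.NaturalCoefficients.Default as NaturalCoefficients
open import Data.Bool.Base using (Bool; true; false; _xor_; _∧_)
import Data.Bool.Properties as Bool
open import Data.Fin.Base using (Fin; zero; suc; toℕ; fromℕ; inject₁; inject≤; punchIn; punchOut)
import Data.Fin.Properties as Fin
import Data.Maybe.Base as Maybe
open import Data.Nat.Base as ℕ using (ℕ; zero; suc; _∸_; _!; NonZero; _≤_)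
open import Data.Nat.Combinatorics using (_C_; nCn≡1; nCk≡n!/k![n-k]!; k![n∸k]!∣n!)
open import Data.Nat.Coprimality using (gcd≡1⇒coprime; coprime-Bézout)
open import Data.Nat.Divisibility
open import Data.Nat.DivMod using (m/n*n≡m)
open import Data.Nat.GCD using (gcd; gcd[m,n]∣m; gcd[m,n]∣n; gcd[m,n]≡0⇒n≡0; module Bézout)
open import Data.Nat.Primality
  using (Prime; euclidsLemma; ¬prime[0]; prime[2]; prime⇒irreducible; prime⇒nonZero; prime⇒nonTrivial)
import Data.Nat.Properties as ℕ
open import Data.Nat.Tactic.RingSolver using (solve-∀)
open import Data.Product.Base using (∃; _×_; _,_; proj₁; proj₂)
open import Data.Sum.Base using (inj₁; inj₂; [_,_]′)
open import Data.Vec.Base using (Vec; []; _∷_; replicate)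
open import Function.Base using (_∘_; const; id)
open import Function.Bundles using (Inverse; _⇔_; mk⇔)
import Function.Construct.Composition as Composition
import Function.Construct.Symmetry as Symmetry
open import Function.Definitions using (Injective)
open import Level using (_⊔_)
open import Relation.Binary.Bundles using (Setoid)
open import Relation.Binary.Construct.Add.Supremum.NonStrict _≤_ using ([_]; _≤⊤⁺; [≤]-injective)
open import Relation.Binary.Definitions using (Decidable; _Respects_)
open import Relation.Binary.PropositionalEquality as ≡ using (_≡_; _≢_)
import Relation.Binary.Reasoning.Setoid as SetoidReasoning
open import Relation.Nullary using (¬_; yes; no; contradiction)
open import Relation.Nullary.Decidable using (map′; ¬?; decidable-stable; dec⇒maybe)
open import Relation.Unary as Unary using (Pred)

-- When q - 1 and Q + 1 are coprime.

module NumberTheory where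
  open import Data.Nat.Base
  open import Data.Nat.Properties
  open import Relation.Binary.PropositionalEquality

  open ≡-Reasoning

  ¬2∣⇒odd : ∀ m → ¬ 2 ∣ m → ∃ λ j → m ≡ suc (j * 2)
  ¬2∣⇒odd 0 2∤0 = contradiction (2 ∣0) 2∤0
  ¬2∣⇒odd 1 _   = 0 , refl
  ¬2∣⇒odd (suc (suc m)) 2∤m+2 with ¬2∣⇒odd m (λ 2∣m → 2∤m+2 (∣m∣n⇒∣m+n ∣-refl 2∣m))
  ... | j , eq = suc j , cong (λ t → suc (suc t)) eq

  -- Truncation does no harm at a = 0, where both sides vanish.
  a∸1∣a^n∸1 : ∀ a n → a ∸ 1 ∣ a ^ n ∸ 1
  a∸1∣a^n∸1 zero    zero    = ∣-refl
  a∸1∣a^n∸1 zero    (suc n) = ∣-refl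
  a∸1∣a^n∸1 (suc b) n       = divides (proj₁ (go n)) (cong (_∸ 1) (proj₂ (go n)))
    where
    step : ∀ b t → suc b * suc (t * b) ≡ suc ((1 + t + t * b) * b)
    step = solve-∀
    go : ∀ n → ∃ λ t → suc b ^ n ≡ suc (t * b)
    go zero    = 0 , refl
    go (suc n) with go n
    ... | t , eq = 1 + t + t * b , trans (cong (suc b *_) eq) (step b t)

  -- The induction rests on a^2 (a^n + 1) + (a + 1) = a (a + 1) + (a^(n+2) + 1), written so as to
  -- avoid subtraction.
  a+1∣a^odd+1 : ∀ a j → a + 1 ∣ a ^ suc (j * 2) + 1
  a+1∣a^odd+1 a zero    = divides 1 (eq a)
    where
    eq : ∀ a → a * 1 + 1 ≡ 1 * (a + 1)
    eq = solve-∀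
  a+1∣a^odd+1 a (suc j) = ∣m+n∣m⇒∣n (subst (a + 1 ∣_) (eq a (a ^ (j * 2)))
      (∣m∣n⇒∣m+n (∣n⇒∣m*n (a * a) (a+1∣a^odd+1 a j)) (divides 1 refl))) (n∣m*n a)
    where
    eq : ∀ a b → a * a * (a * b + 1) + 1 * (a + 1) ≡ a * (a + 1) + (a * (a * (a * b)) + 1)
    eq = solve-∀

  a+1∣a²∸1 : ∀ a → a + 1 ∣ a ^ 2 ∸ 1
  a+1∣a²∸1 zero    = 1∣ 0
  a+1∣a²∸1 (suc b) = divides b (eq b)
    where
    eq : ∀ b → b * 1 + b * (suc (b * 1)) ≡ b * (suc b + 1)
    eq = solve-∀

  ^-monoʳ-∣ : ∀ a {m n} → m ≤ n → a ^ m ∣ a ^ n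
  ^-monoʳ-∣ a {m} {n} m≤n = divides (a ^ (n ∸ m))
    (trans (cong (a ^_) (sym (m∸n+n≡m m≤n))) (^-distribˡ-+-* a (n ∸ m) m))

  2∤2^n∸1 : ∀ {n} → 0 < n → ¬ 2 ∣ 2 ^ n ∸ 1
  2∤2^n∸1 {suc n} _ 2∣ = contradiction (∣1⇒≡1
    (∣m+n∣m⇒∣n (subst (2 ∣_) (sym (m∸n+n≡m (m^n>0 2 (suc n)))) (m∣m*n (2 ^ n))) 2∣)) λ ()

  n∸1∣n+1⇒n∸1∣2 : ∀ {d n} → 0 < n → d ∣ n ∸ 1 → d ∣ n + 1 → d ∣ 2
  n∸1∣n+1⇒n∸1∣2 {d} {suc n} _ d∣n d∣n+2 =
    ∣m+n∣m⇒∣n (subst (d ∣_) (sym (+-suc n 1)) d∣n+2) d∣n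

  2∣n∸1⇒2∣n+1 : ∀ {n} → 0 < n → 2 ∣ n ∸ 1 → 2 ∣ n + 1
  2∣n∸1⇒2∣n+1 {suc n} _ 2∣n = subst (2 ∣_) (+-suc n 1) (∣m∣n⇒∣m+n 2∣n ∣-refl)

  -- For odd `p` both arguments of the gcd are even.
  coprime⇒p≡2 : ∀ {p} k ℓ → Prime p → gcd (p ^ k ∸ 1) (p ^ ℓ + 1) ≡ 1 → p ≡ 2
  coprime⇒p≡2 {p} k ℓ p-prime gcd≡1 with 2 ∣? p
  ... | yes 2∣p with prime⇒irreducible p-prime 2∣p
  ...   | inj₂ 2≡p = sym 2≡p
  coprime⇒p≡2 {p} k ℓ p-prime gcd≡1 | no 2∤p
    with j , refl ← ¬2∣⇒odd p 2∤p
    = contradiction (gcd≡1⇒coprime gcd≡1 (2∣p^ k , 2∣n∸1⇒2∣n+1 (m^n>0 p ℓ) (2∣p^ ℓ))) λ ()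
    where
    2∣p^ : ∀ n → 2 ∣ p ^ n ∸ 1
    2∣p^ n = ∣-trans (n∣m*n j) (a∸1∣a^n∸1 p n)

  -- Suppose that 2^j exactly divides ℓ > 0 and that 2^(j+1) divides `k`, and put `X` = 2^(2^j). As
  -- ℓ / 2^j is odd, X + 1 divides 2^ℓ + 1; it also divides X^2 - 1, hence 2^k - 1. For ℓ = 0 the
  -- order of ℓ is infinite.
  coprime⇒ord₂≤ : ∀ k ℓ → 0 < k → gcd (2 ^ k ∸ 1) (2 ^ ℓ + 1) ≡ 1 → ord₂ k ≤∞ ord₂ ℓ
  coprime⇒ord₂≤ k zero        k>0 gcd≡1 = _ ≤⊤⁺
  coprime⇒ord₂≤ k ℓ@(suc _) k>0 gcd≡1
    with i , eqᵢ , 2^i∣k , _ ← ord₂-spec k {{>-nonZero k>0}}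
       | j , eqⱼ , divides m ℓ≡m*2^j , j-max ← ord₂-spec ℓ
    rewrite eqᵢ | eqⱼ with i ≤? j
  ... | yes i≤j = [ i≤j ]
  ... | no  i≰j
    with m′ , refl ← ¬2∣⇒odd m (λ 2∣m → 1+n≰n (j-max (subst (2 ^ suc j ∣_) (sym ℓ≡m*2^j) (*-monoˡ-∣ (2 ^ j) 2∣m))))
    = contradiction (gcd≡1⇒coprime gcd≡1 (X+1∣q∸1 , X+1∣Q+1)) (>⇒≢ (+-monoˡ-< 1 (m^n>0 2 (2 ^ j))))
    where
    X = 2 ^ (2 ^ j)
    X+1∣Q+1 : X + 1 ∣ 2 ^ ℓ + 1
    X+1∣Q+1 = subst (λ t → X + 1 ∣ t + 1)
      (begin
        X ^ suc (m′ * 2)          ≡⟨ ^-*-assoc 2 (2 ^ j) (suc (m′ * 2)) ⟩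
        2 ^ (2 ^ j * suc (m′ * 2)) ≡⟨ cong (2 ^_) (trans (*-comm (2 ^ j) _) (sym ℓ≡m*2^j)) ⟩
        2 ^ ℓ                     ∎)
      (a+1∣a^odd+1 X m′)
    2^1+j∣k : 2 ^ suc j ∣ k
    2^1+j∣k = ∣-trans (^-monoʳ-∣ 2 (≰⇒> i≰j)) 2^i∣k
    X+1∣q∸1 : X + 1 ∣ 2 ^ k ∸ 1
    X+1∣q∸1 with divides t k≡ ← 2^1+j∣k = ∣-trans (a+1∣a²∸1 X) (subst (λ s → X ^ 2 ∸ 1 ∣ s ∸ 1)
      (begin
        (X ^ 2) ^ t         ≡⟨ cong (_^ t) (^-*-assoc 2 (2 ^ j) 2) ⟩
        (2 ^ (2 ^ j * 2)) ^ t ≡⟨ ^-*-assoc 2 (2 ^ j * 2) t ⟩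
        2 ^ (2 ^ j * 2 * t)   ≡⟨ cong (2 ^_) (trans (*-comm (2 ^ j * 2) t) (trans (cong (t *_) (*-comm (2 ^ j) 2)) (sym k≡))) ⟩
        2 ^ k ∎)
      (a∸1∣a^n∸1 (X ^ 2) t))

  -- Turns the comparison of orders into a divisibility, which also covers ℓ = 0, where the order is
  -- infinite.
  ord₂≤⇒ : ∀ k ℓ → 0 < k → ord₂ k ≤∞ ord₂ ℓ →
           ∃ λ j → ∃ λ s → k ≡ suc (j * 2) * 2 ^ s × 2 ^ s ∣ ℓ
  ord₂≤⇒ k ℓ k>0 ord≤
    with s , eq , divides m k≡m*2^s , s-max ← ord₂-spec k {{>-nonZero k>0}}
    with j , refl ← ¬2∣⇒odd m (λ 2∣m → 1+n≰n (s-max (subst (2 ^ suc s ∣_) (sym k≡m*2^s) (*-monoˡ-∣ (2 ^ s) 2∣m))))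
    = j , s , k≡m*2^s , 2^s∣ ℓ ord≤
    where
    2^s∣ : ∀ ℓ → ord₂ k ≤∞ ord₂ ℓ → 2 ^ s ∣ ℓ
    2^s∣ zero      _    = _ ∣0
    2^s∣ ℓ@(suc _) ord≤ with i , eqᵢ , 2^i∣ℓ , _ ← ord₂-spec ℓ rewrite eq | eqᵢ
      = ∣-trans (^-monoʳ-∣ 2 ([≤]-injective ord≤)) 2^i∣ℓ

  -- Write k = m 2^s with m odd.  Then 2^(ℓm) is a power of both 2^k and 2^ℓ, so a common divisor d of
  -- 2^k - 1 and 2^ℓ + 1 divides 2^(ℓm) - 1 and 2^(ℓm) + 1, hence 2; but 2^k - 1 is odd.
  ord₂≤⇒coprime : ∀ k ℓ → 0 < k → ord₂ k ≤∞ ord₂ ℓ → gcd (2 ^ k ∸ 1) (2 ^ ℓ + 1) ≡ 1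
  ord₂≤⇒coprime k ℓ k>0 ord≤ with j , s , k≡m*2^s , divides t ℓ≡t*2^s ← ord₂≤⇒ k ℓ k>0 ord≤
    = d≡1 (prime⇒irreducible prime[2] d∣2)
    where
    m = suc (j * 2)
    d = gcd (2 ^ k ∸ 1) (2 ^ ℓ + 1)
    k*t≡ℓ*m : k * t ≡ ℓ * m
    k*t≡ℓ*m = begin
      k * t          ≡⟨ cong (_* t) k≡m*2^s ⟩
      m * 2 ^ s * t  ≡⟨ eq m (2 ^ s) t ⟩
      t * 2 ^ s * m  ≡⟨ cong (_* m) ℓ≡t*2^s ⟨
      ℓ * m          ∎
      where
      eq : ∀ a b c → a * b * c ≡ c * b * a
      eq = solve-∀
    d∣2 : d ∣ 2
    d∣2 = n∸1∣n+1⇒n∸1∣2 (m^n>0 2 (ℓ * m))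
      (subst (λ e → d ∣ e ∸ 1) (trans (^-*-assoc 2 k t) (cong (2 ^_) k*t≡ℓ*m))
        (∣-trans (gcd[m,n]∣m (2 ^ k ∸ 1) _) (a∸1∣a^n∸1 (2 ^ k) t)))
      (subst (λ e → d ∣ e + 1) (^-*-assoc 2 ℓ m)
        (∣-trans (gcd[m,n]∣n (2 ^ k ∸ 1) _) (a+1∣a^odd+1 (2 ^ ℓ) j)))
    d≢2 : d ≢ 2
    d≢2 d≡2 = 2∤2^n∸1 k>0 (subst (_∣ 2 ^ k ∸ 1) d≡2 (gcd[m,n]∣m (2 ^ k ∸ 1) (2 ^ ℓ + 1)))
    d≡1 : _ → d ≡ 1
    d≡1 (inj₁ d≡1) = d≡1
    d≡1 (inj₂ d≡2) = contradiction d≡2 d≢2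

  coprime⇔ord₂≤ : ∀ {p} k ℓ → Prime p → 0 < k →
                  gcd (p ^ k ∸ 1) (p ^ ℓ + 1) ≡ 1 ⇔ (p ≡ 2 × ord₂ k ≤∞ ord₂ ℓ)
  coprime⇔ord₂≤ {p} k ℓ p-prime k>0 = mk⇔ to λ where (refl , ord≤) → ord₂≤⇒coprime k ℓ k>0 ord≤
    where
    to : gcd (p ^ k ∸ 1) (p ^ ℓ + 1) ≡ 1 → p ≡ 2 × ord₂ k ≤∞ ord₂ ℓ
    to gcd≡1 with refl ← coprime⇒p≡2 k ℓ p-prime gcd≡1 = refl , coprime⇒ord₂≤ k ℓ k>0 gcd≡1

-- Binomial coefficients modulo a prime, and the pigeonhole principle.

prime∤! : ∀ {p k} → Prime p → k ℕ.< p → ¬ p ∣ k !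
prime∤! {p} {zero}  p-prime _   p∣1 = ℕ.nonTrivial⇒≢1 {{prime⇒nonTrivial p-prime}} (∣1⇒≡1 p∣1)
prime∤! {p} {suc k} p-prime k<p p∣  = [ >⇒∤ k<p , prime∤! p-prime (ℕ.<-trans (ℕ.n<1+n k) k<p) ]′
  (euclidsLemma (suc k) (k !) p-prime p∣)

n∣n! : ∀ {n} → 0 ℕ.< n → n ∣ n !
n∣n! {suc n} _ = m∣m*n (n !)

-- The prime divides p! = C(p,k) k! (p-k)!, but it divides neither of the two factorials on the
-- right.
prime∣C : ∀ {p k} → Prime p → 0 ℕ.< k → k ℕ.< p → p ∣ p C k
prime∣C {p} {k} p-prime k>0 k<p
  with euclidsLemma (p C k) (k ! ℕ.* (p ∸ k) !) p-prime
         (≡.subst (p ∣_) (≡.sym pCk*) (n∣n! (ℕ.<-≤-trans k>0 (ℕ.<⇒≤ k<p))))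
  where
  instance _ = ℕ._!*_!≢0 k (p ∸ k)
  pCk* : (p C k) ℕ.* (k ! ℕ.* (p ∸ k) !) ≡ p !
  pCk* = ≡.trans (≡.cong (ℕ._* (k ! ℕ.* (p ∸ k) !)) (nCk≡n!/k![n-k]! (ℕ.<⇒≤ k<p)))
                 (m/n*n≡m (k![n∸k]!∣n! (ℕ.<⇒≤ k<p)))
... | inj₁ p∣pCk = p∣pCk
... | inj₂ p∣k!* with euclidsLemma (k !) ((p ∸ k) !) p-prime p∣k!*
...   | inj₁ p∣k!     = contradiction p∣k! (prime∤! p-prime k<p)
...   | inj₂ p∣[p-k]! = contradiction p∣[p-k]! (prime∤! p-prime (ℕ.∸-monoʳ-< k>0 (ℕ.<⇒≤ k<p)))

-- If some `j` were missed, punching it out would inject `Fin (suc m)` into `Fin m`.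
injective⇒surjective : ∀ {m} {g : Fin m → Fin m} → Injective _≡_ _≡_ g → ∀ j → ∃ λ i → g i ≡ j
injective⇒surjective {suc m} {g} g-inj j with Fin.any? (λ i → g i Fin.≟ j)
... | yes hit  = hit
... | no  miss = contradiction
  (Fin.injective⇒≤ {f = punchOut ∘ j≢g} (λ {x} {y} → g-inj ∘ Fin.punchOut-injective (j≢g x) (j≢g y)))
  ℕ.1+n≰n
  where
  j≢g : ∀ i → j ≢ g i
  j≢g i j≡gᵢ = miss (i , ≡.sym j≡gᵢ)

-- Additivity of the Frobenius map in characteristic p.

module Frobenius {c ℓ} (R : CommutativeRing c ℓ) where
  open CommutativeRing R renaming (zero to *-zero)
  open Exp commutativeSemiring using (_^_; ^-congʳ; ^-congˡ; ^-assocʳ)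
  open Sum +-commutativeMonoid using (sum; sum-init-last; sum-cong-≋; sum-replicate-zero)
  open Mult semiring using (×-homo-1; ×-congˡ; ×-congʳ; ×-assocˡ; ×-assoc-*) renaming (_×_ to _·_)
  open Binomial commutativeSemiring using (theorem; binomialTerm)
  open SetoidReasoning setoid

  p∣m⇒m·x≈0 : ∀ {p m} → p · 1# ≈ 0# → p ∣ m → ∀ x → m · x ≈ 0#
  p∣m⇒m·x≈0 {p} {m} p·1≈0 (divides t m≡tp) x = begin
    m · x           ≈⟨ ×-congˡ (≡.trans m≡tp (ℕ.*-comm t p)) ⟩
    (p ℕ.* t) · x   ≈⟨ ×-assocˡ x p t ⟨
    p · (t · x)     ≈⟨ ×-congʳ p (*-identityˡ (t · x)) ⟨
    p · (1# * (t · x)) ≈⟨ ×-assoc-* p 1# (t · x) ⟨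
    p · 1# * (t · x)   ≈⟨ *-congʳ p·1≈0 ⟩
    0# * (t · x)       ≈⟨ zeroˡ _ ⟩
    0# ∎

  -- In the binomial expansion `p` divides every coefficient except the two outer ones, so only the
  -- outer terms survive.
  ^p-homo-+ : ∀ {p} → Prime p → p · 1# ≈ 0# → ∀ x y → (x + y) ^ p ≈ x ^ p + y ^ p
  ^p-homo-+ {zero}  p-prime _ x y = contradiction p-prime ¬prime[0]
  ^p-homo-+ {suc r} p-prime p·1≈0 x y = begin
    (x + y) ^ suc r
      ≈⟨ theorem (suc r) x y ⟩
    t zero + sum (λ k → t (suc k))
      ≈⟨ +-congˡ (sum-init-last (λ k → t (suc k))) ⟩
    t zero + (sum (λ k → t (suc (inject₁ k))) + t (fromℕ (suc r)))
      ≈⟨ +-cong (trans (×-homo-1 _) (*-identityˡ _)) (+-cong (trans (sum-cong-≋ middle) (sum-replicate-zero r)) last) ⟩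
    y ^ suc r + (0# + x ^ suc r)
      ≈⟨ trans (+-congˡ (+-identityˡ _)) (+-comm _ _) ⟩
    x ^ suc r + y ^ suc r ∎
    where
    t : Fin (suc (suc r)) → Carrier
    t = binomialTerm x y (suc r)
    middle : ∀ k → t (suc (inject₁ k)) ≈ 0#
    middle k = p∣m⇒m·x≈0 p·1≈0 (prime∣C p-prime (ℕ.s≤s ℕ.z≤n)
      (ℕ.s≤s (≡.subst (ℕ._< r) (≡.sym (Fin.toℕ-inject₁ k)) (Fin.toℕ<n k)))) _
    last : t (fromℕ (suc r)) ≈ x ^ suc r
    last = begin
      (suc r C m) · (x ^ m * y ^ (suc r ∸ m))           ≈⟨ ×-congˡ (≡.trans (≡.cong (suc r C_) m≡) (nCn≡1 (suc r))) ⟩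
      1 · (x ^ m * y ^ (suc r ∸ m))                     ≈⟨ ×-homo-1 _ ⟩
      x ^ m * y ^ (suc r ∸ m)                           ≈⟨ *-cong (^-congʳ x m≡) (^-congʳ y (≡.trans (≡.cong (suc r ∸_) m≡) (ℕ.n∸n≡0 r))) ⟩
      x ^ suc r * 1#                                    ≈⟨ *-identityʳ _ ⟩
      x ^ suc r                                         ∎
      where
      m = suc (toℕ (fromℕ r))
      m≡ : m ≡ suc r
      m≡ = ≡.cong suc (Fin.toℕ-fromℕ r)

  ^p^-homo-+ : ∀ {p} → Prime p → p · 1# ≈ 0# → ∀ k x y → (x + y) ^ (p ℕ.^ k) ≈ x ^ (p ℕ.^ k) + y ^ (p ℕ.^ k)
  ^p^-homo-+ {p} _       _     zero    x y = trans (*-identityʳ _) (sym (+-cong (*-identityʳ x) (*-identityʳ y)))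
  ^p^-homo-+ {p} p-prime p·1≈0 (suc k) x y = begin
    (x + y) ^ (p ℕ.* p ℕ.^ k)            ≈⟨ ^-assocʳ (x + y) p (p ℕ.^ k) ⟨
    ((x + y) ^ p) ^ (p ℕ.^ k)            ≈⟨ ^-congˡ (p ℕ.^ k) (^p-homo-+ p-prime p·1≈0 x y) ⟩
    (x ^ p + y ^ p) ^ (p ℕ.^ k)          ≈⟨ ^p^-homo-+ p-prime p·1≈0 k (x ^ p) (y ^ p) ⟩
    (x ^ p) ^ (p ℕ.^ k) + (y ^ p) ^ (p ℕ.^ k) ≈⟨ +-cong (^-assocʳ x p _) (^-assocʳ y p _) ⟩
    x ^ (p ℕ.* p ℕ.^ k) + y ^ (p ℕ.* p ℕ.^ k) ∎

-- Decidable equality and inverses from an enumeration.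

module Enumerated {c ℓ} (S : Setoid c ℓ) {n} (enum : Inverse S (≡.setoid (Fin n))) where
  open Setoid S
  open Inverse enum using (to; to-cong; from-cong; strictlyInverseʳ)

  to-injective : ∀ {x y} → to x ≡ to y → x ≈ y
  to-injective {x} {y} eq = trans (sym (strictlyInverseʳ x)) (trans (from-cong eq) (strictlyInverseʳ y))

  infix 4 _≟_
  _≟_ : Decidable _≈_
  x ≟ y = map′ to-injective to-cong (to x Fin.≟ to y)

commutativeRing : ∀ {c ℓ₁ ℓ₂} → HeytingField c ℓ₁ ℓ₂ → CommutativeRing c ℓ₁
commutativeRing F = HeytingCommutativeRing.commutativeRing (HeytingField.heytingCommutativeRing F)

module Heyting {c ℓ₁ ℓ₂} (F : HeytingField c ℓ₁ ℓ₂) where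
  open HeytingField F
  open HeytingProperties heytingCommutativeRing using (1#0; x-0≈x)

  1≉0 : ¬ 1# ≈ 0#
  1≉0 1≈0 = proj₂ (tight 1# 0#) 1≈0 1#0

  -- Tightness only refutes that x has no inverse; a search through the carrier then finds one.
  inverse : ∀ {n} → HasOrder F n → ∀ {x} → ¬ x ≈ 0# → ∃ λ y → x * y ≈ 1#
  inverse enum {x} x≉0 with Fin.any? (λ i → x * Inverse.from enum i ≟ 1#)
    where open Enumerated setoid enum
  ... | yes (i , xxᵢ≈1) = _ , xxᵢ≈1
  ... | no  none = contradiction (proj₁ (tight x 0#) ¬x#0) x≉0
    where
    open Inverse enum
    ¬x#0 : ¬ x # 0#
    ¬x#0 x#0 with y , _ , [x-0]y≈1 ← #⇒invertible x#0 =
      none (to y , trans (*-cong (sym (x-0≈x x)) (strictlyInverseʳ y)) [x-0]y≈1)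

-- Finite fields: Fermat's theorem, roots of polynomials, counting.

module FiniteField {c ℓ₁ ℓ₂} (F : HeytingField c ℓ₁ ℓ₂) {n} (enum : HasOrder F n) where

  open CommutativeRing (commutativeRing F) renaming (zero to *-zero)
  open Exp commutativeSemiring
  open RingProperties ring using (-‿distribʳ-*; x≈y⇒x∙y⁻¹≈ε; x∙y⁻¹≈ε⇒x≈y)
  open Mult semiring using (×1-homo-*) renaming (_×_ to _·_)
  open SetoidReasoning setoid
  open Inverse enum using (to; from; to-cong; from-cong; strictlyInverseˡ; strictlyInverseʳ)
  open NaturalCoefficients commutativeSemiring using (solve; _:+_; _:*_; _:=_; con)

  open Enumerated setoid enum public
  open Heyting F using (1≉0) public

  inverse : ∀ {x} → x ≉ 0# → ∃ λ y → x * y ≈ 1#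
  inverse = Heyting.inverse F enum

  *-cancelˡ : ∀ {a x y} → a ≉ 0# → a * x ≈ a * y → x ≈ y
  *-cancelˡ {a} {x} {y} a≉0 ax≈ay with b , ab≈1 ← inverse a≉0 = begin
    x            ≈⟨ lemma x ⟩
    b * (a * x)  ≈⟨ *-congˡ ax≈ay ⟩
    b * (a * y)  ≈⟨ lemma y ⟨
    y            ∎
    where
    lemma : ∀ x → x ≈ b * (a * x)
    lemma x = begin
      x           ≈⟨ *-identityˡ x ⟨
      1# * x      ≈⟨ *-congʳ (trans (sym ab≈1) (*-comm a b)) ⟩
      b * a * x   ≈⟨ *-assoc b a x ⟩
      b * (a * x) ∎

  xy≈0⇒y≈0 : ∀ {x y} → x ≉ 0# → x * y ≈ 0# → y ≈ 0#
  xy≈0⇒y≈0 x≉0 xy≈0 = *-cancelˡ x≉0 (trans xy≈0 (sym (zeroʳ _)))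

  divide : ∀ {d} → d ≉ 0# → ∀ x → ∃ λ a → a * d ≈ x
  divide {d} d≉0 x with e , de≈1 ← inverse d≉0 = x * e ,
    trans (*-assoc x e d) (trans (*-congˡ (trans (*-comm e d) de≈1)) (*-identityʳ x))

  ^≉0 : ∀ {x} m → x ≉ 0# → x ^ m ≉ 0#
  ^≉0 zero    x≉0 = 1≉0
  ^≉0 (suc m) x≉0 = ^≉0 m x≉0 ∘ xy≈0⇒y≈0 x≉0

  0^≈0 : ∀ m .{{_ : NonZero m}} → 0# ^ m ≈ 0#
  0^≈0 (suc m) = zeroˡ _

  1^≈1 : ∀ m → 1# ^ m ≈ 1#
  1^≈1 zero    = refl
  1^≈1 (suc m) = trans (*-identityˡ _) (1^≈1 m)

  -- Stated for any commutative monoid because it serves twice: additively for `n·1≈0` and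
  -- multiplicatively for `x^n≈x`.
  sum-rearrange : ∀ {a b} (M : CommutativeMonoid a b) →
    let module M = CommutativeMonoid M in
    (h : Carrier → M.Carrier) → (∀ {x y} → x ≈ y → h x M.≈ h y) →
    (π : Inverse setoid setoid) → Sum.sum M (h ∘ from) M.≈ Sum.sum M (h ∘ Inverse.to π ∘ from)
  sum-rearrange M h h-cong π = M.trans (sum-permute (h ∘ from) π′)
    (sum-cong-≋ λ i → h-cong (strictlyInverseʳ (Inverse.to π (from i))))
    where
    module M = CommutativeMonoid M
    open Sum M
    -- The permutation of the indices that corresponds to `π` under the enumeration.
    π′ = Composition.inverse (Symmetry.inverse enum) (Composition.inverse π enum)

  -- Translation by `1#` permutes the field, so the sum of all elements equals itself plus `n · 1#`.
  n·1≈0 : n · 1# ≈ 0#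
  n·1≈0 = +-cancelˡ (sum from) _ _ (begin
    sum from + n · 1#            ≈⟨ +-congˡ (sum-replicate n) ⟨
    sum from + sum {n} (const 1#)    ≈⟨ ∑-distrib-+ from (const 1#) ⟨
    sum (λ i → from i + 1#)      ≈⟨ sum-rearrange +-commutativeMonoid (λ x → x) (λ x → x) shift ⟨
    sum from                     ≈⟨ +-identityʳ _ ⟨
    sum from + 0#                ∎)
    where
    open Sum +-commutativeMonoid
    open RingProperties ring using (+-cancelˡ)
    shift : Inverse setoid setoid
    shift = record
      { to = _+ 1# ; from = _- 1# ; to-cong = +-congʳ ; from-cong = +-congʳ
      ; inverse = (λ {x} eq → trans (+-congʳ eq) (trans (+-assoc x (- 1#) 1#)
                    (trans (+-congˡ (-‿inverseˡ 1#)) (+-identityʳ x))))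
                , (λ {x} eq → trans (+-congʳ eq) (trans (+-assoc x 1# (- 1#))
                    (trans (+-congˡ (-‿inverseʳ 1#)) (+-identityʳ x)))) }

  -- Fermat's argument multiplies all elements of F; the factor at x = 0 has to be replaced by a constant.
  nonzeroOr : Carrier → Carrier → Carrier → Carrier
  nonzeroOr a b x with x ≟ 0#
  ... | yes _ = a
  ... | no  _ = b

  nonzeroOr-0 : ∀ {a b x} → x ≈ 0# → nonzeroOr a b x ≈ a
  nonzeroOr-0 {x = x} x≈0 with x ≟ 0#
  ... | yes _ = refl
  ... | no x≉0 = contradiction x≈0 x≉0

  nonzeroOr-≉0 : ∀ {a b x} → x ≉ 0# → nonzeroOr a b x ≈ b
  nonzeroOr-≉0 {x = x} x≉0 with x ≟ 0#
  ... | yes x≈0 = contradiction x≈0 x≉0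
  ... | no _ = refl

  prod≉0 : ∀ {m} (t : Fin m → Carrier) → (∀ i → t i ≉ 0#) → Sum.sum *-commutativeMonoid t ≉ 0#
  prod≉0 {zero}  t t≉0 = 1≉0
  prod≉0 {suc m} t t≉0 = prod≉0 (t ∘ suc) (t≉0 ∘ suc) ∘ xy≈0⇒y≈0 (t≉0 zero)

  prod-single : ∀ {m} (i : Fin m) (t : Fin m → Carrier) → (∀ j → ¬ j ≡ i → t j ≈ 1#) →
                Sum.sum *-commutativeMonoid t ≈ t i
  prod-single {suc m} i t t≈1 = begin
    sum t                     ≈⟨ sum-remove t ⟩
    t i * sum (λ j → t (punchIn i j)) ≈⟨ *-congˡ (sum-cong-≋ λ j → t≈1 (punchIn i j) (Fin.punchInᵢ≢i i j)) ⟩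
    t i * sum {m} (const 1#)  ≈⟨ *-congˡ (sum-replicate-zero m) ⟩
    t i * 1#                  ≈⟨ *-identityʳ _ ⟩
    t i                       ∎
    where
    open Sum *-commutativeMonoid

  -- Multiplication by a nonzero `a` permutes the field, so the product `P` of the nonzero elements
  -- absorbs one factor `a` for each of them. Of the `n` factors in `a ^ n` only the one belonging
  -- to zero is left over, and `P` cancels.
  x^n≈x : ∀ a → a ^ n ≈ a
  x^n≈x a with a ≟ 0#
  ... | yes a≈0 = trans (^-congˡ n a≈0) (trans (0^≈0 n {{Fin.nonZeroIndex (to 0#)}}) (sym a≈0))
  ... | no  a≉0 with b , ab≈1 ← inverse a≉0 = *-cancelˡ (prod≉0 (unit ∘ from) (unit≉0 ∘ from)) (begin
    P * a ^ n                                        ≈⟨ *-congˡ (sum-replicate n) ⟨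
    P * prod {n} (const a)                           ≈⟨ *-congˡ (sum-cong-≋ {n} λ i → split (from i)) ⟨
    P * prod {n} (λ i → atZero (from i) * offZero (from i)) ≈⟨ *-congˡ (∑-distrib-+ (atZero ∘ from) (offZero ∘ from)) ⟩
    P * (prod (atZero ∘ from) * prod (offZero ∘ from)) ≈⟨ *-congˡ (*-comm _ _) ⟩
    P * (prod (offZero ∘ from) * prod (atZero ∘ from)) ≈⟨ *-assoc _ _ _ ⟨
    P * prod (offZero ∘ from) * prod (atZero ∘ from)   ≈⟨ *-cong (sym (∑-distrib-+ (unit ∘ from) (offZero ∘ from))) prod-atZero ⟩
    prod (λ i → unit (from i) * offZero (from i)) * a  ≈⟨ *-congʳ (sum-cong-≋ {n} λ i → unit-scale (from i)) ⟨
    prod (λ i → unit (a * from i)) * a               ≈⟨ *-congʳ (sum-rearrange *-commutativeMonoid unit unit-cong scale) ⟨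
    P * a ∎)
    where
    open Sum *-commutativeMonoid renaming (sum to prod)
    unit atZero offZero : Carrier → Carrier
    unit x = nonzeroOr 1# x x
    atZero = nonzeroOr a 1#
    offZero = nonzeroOr 1# a
    P = prod (unit ∘ from)

    unit≉0 : ∀ x → unit x ≉ 0#
    unit≉0 x eq with x ≟ 0#
    ... | yes _   = 1≉0 eq
    ... | no  x≉0 = x≉0 eq

    split : ∀ x → atZero x * offZero x ≈ a
    split x with x ≟ 0#
    ... | yes _ = *-identityʳ a
    ... | no  _ = *-identityˡ a

    unit-cong : ∀ {x y} → x ≈ y → unit x ≈ unit y
    unit-cong {x} {y} x≈y with x ≟ 0# | y ≟ 0#
    ... | yes _   | yes _   = refl
    ... | no _    | no _    = x≈y
    ... | yes x≈0 | no y≉0  = contradiction (trans (sym x≈y) x≈0) y≉0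
    ... | no x≉0  | yes y≈0 = contradiction (trans x≈y y≈0) x≉0

    unit-scale : ∀ x → unit (a * x) ≈ unit x * offZero x
    unit-scale x with x ≟ 0#
    ... | yes x≈0 = trans (nonzeroOr-0 (trans (*-congˡ x≈0) (zeroʳ a))) (sym (*-identityʳ 1#))
    ... | no  x≉0 = trans (nonzeroOr-≉0 (x≉0 ∘ xy≈0⇒y≈0 a≉0)) (*-comm a x)

    prod-atZero : prod (atZero ∘ from) ≈ a
    prod-atZero = trans
      (prod-single (to 0#) (atZero ∘ from) λ j j≢ → nonzeroOr-≉0 λ from-j≈0 →
        j≢ (≡.trans (≡.sym (strictlyInverseˡ j)) (to-cong from-j≈0)))
      (nonzeroOr-0 (strictlyInverseʳ 0#))

    scale : Inverse setoid setoid
    scale = record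
      { to = a *_ ; from = b *_ ; to-cong = *-congˡ ; from-cong = *-congˡ
      ; inverse = (λ {x} eq → trans (*-congˡ eq) (trans (sym (*-assoc a b x))
                    (trans (*-congʳ ab≈1) (*-identityˡ x))))
                , (λ {x} eq → trans (*-congˡ eq) (trans (sym (*-assoc b a x))
                    (trans (*-congʳ (trans (*-comm b a) ab≈1)) (*-identityˡ x)))) }

  -- The e-th power of `p · 1#` is `n · 1#`, which vanishes, and a field has no nonzero nilpotent
  -- elements.
  p^e≡n⇒p·1≈0 : ∀ {p} e → p ℕ.^ e ≡ n → p · 1# ≈ 0#
  p^e≡n⇒p·1≈0 {p} e p^e≡n = decidable-stable (p · 1# ≟ 0#) λ p·1≉0 →
    ^≉0 e p·1≉0 (trans (sym (·1-^ e)) (trans (Mult.×-congˡ semiring p^e≡n) n·1≈0))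
    where
    ·1-^ : ∀ e → (p ℕ.^ e) · 1# ≈ (p · 1#) ^ e
    ·1-^ zero    = +-identityʳ 1#
    ·1-^ (suc e) = trans (×1-homo-* p (p ℕ.^ e)) (*-congˡ (·1-^ e))

  -- The monic polynomial with the given lower coefficients, constant term first.
  evalMonic : ∀ {m} → Vec Carrier m → Carrier → Carrier
  evalMonic []       x = 1#
  evalMonic (a ∷ as) x = x * evalMonic as x + a

  x≈x-r+r : ∀ x r → x ≈ x - r + r
  x≈x-r+r x r = sym (trans (+-assoc x (- r) r) (trans (+-congˡ (-‿inverseˡ r)) (+-identityʳ x)))

  -- Horner's scheme for division by X - r: the remainder is the value at `r`, and the coefficients
  -- of the quotient are the intermediate values of the scheme.
  divideMonic : ∀ {m} (as : Vec Carrier (suc m)) r → ∃ λ (bs : Vec Carrier m) →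
    ∀ x → evalMonic as x ≈ (x - r) * evalMonic bs x + evalMonic as r
  divideMonic (a ∷ []) r = [] , λ x → begin
    x * 1# + a                     ≈⟨ +-congʳ (*-congʳ (x≈x-r+r x r)) ⟩
    (x - r + r) * 1# + a           ≈⟨ solve 3 (λ d r a → (d :+ r) :* con 1 :+ a := d :* con 1 :+ (r :* con 1 :+ a)) refl (x - r) r a ⟩
    (x - r) * 1# + (r * 1# + a)    ∎
  divideMonic (a ∷ as@(_ ∷ _)) r with bs , eq ← divideMonic as r = evalMonic as r ∷ bs , λ x → begin
    x * evalMonic as x + a                                        ≈⟨ +-congʳ (*-congˡ (eq x)) ⟩
    x * ((x - r) * evalMonic bs x + evalMonic as r) + a           ≈⟨ +-congʳ (distribˡ _ _ _) ⟩
    x * ((x - r) * evalMonic bs x) + x * evalMonic as r + a       ≈⟨ +-congʳ (+-congˡ (*-congʳ (x≈x-r+r x r))) ⟩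
    x * ((x - r) * evalMonic bs x) + (x - r + r) * evalMonic as r + a
      ≈⟨ solve 6 (λ x d b e r a → x :* (d :* b) :+ (d :+ r) :* e :+ a := d :* (x :* b :+ e) :+ (r :* e :+ a)) refl
           x (x - r) (evalMonic bs x) (evalMonic as r) r a ⟩
    (x - r) * (x * evalMonic bs x + evalMonic as r) + (r * evalMonic as r + a) ∎

  -- After division by X - r₀ for one root r₀, the other roots are roots of the quotient, whose
  -- degree is one less.
  monic-roots : ∀ {m} (as : Vec Carrier m) (r : Fin (suc m) → Carrier) →
    (∀ {i j} → r i ≈ r j → i ≡ j) → ¬ (∀ i → evalMonic as (r i) ≈ 0#)
  monic-roots []          r r-inj root = 1≉0 (root zero)
  monic-roots as@(_ ∷ _) r r-inj root with bs , eq ← divideMonic as (r zero) =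
    monic-roots bs (r ∘ suc) (Fin.suc-injective ∘ r-inj) λ i →
      xy≈0⇒y≈0 (λ eq0 → contradiction (r-inj (x∙y⁻¹≈ε⇒x≈y _ _ eq0)) λ ()) (begin
        (r (suc i) - r zero) * evalMonic bs (r (suc i))      ≈⟨ +-identityʳ _ ⟨
        (r (suc i) - r zero) * evalMonic bs (r (suc i)) + 0# ≈⟨ +-congˡ (root zero) ⟨
        (r (suc i) - r zero) * evalMonic bs (r (suc i)) + evalMonic as (r zero) ≈⟨ eq (r (suc i)) ⟨
        evalMonic as (r (suc i))                            ≈⟨ root (suc i) ⟩
        0# ∎)

  -- Otherwise X^d - X would have more than `d` roots. This yields both elements outside the fixed
  -- field of x ↦ x^q and nontrivial roots of unity.
  ∃x^d≉x : ∀ d → 2 ℕ.≤ d → d ℕ.< n → ∃ λ x → x ^ d ≉ x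
  ∃x^d≉x 1 (ℕ.s≤s ())
  ∃x^d≉x (suc (suc e)) _ d<n with Fin.any? (λ i → ¬? (from i ^ suc (suc e) ≟ from i))
  ... | yes (i , xᵢ^d≉xᵢ) = from i , xᵢ^d≉xᵢ
  ... | no  none = contradiction root (monic-roots X^d-X (from ∘ embed) embed-inj)
    where
    embed : Fin (suc (suc (suc e))) → Fin n
    embed i = inject≤ i d<n
    embed-inj : ∀ {i j} → from (embed i) ≈ from (embed j) → i ≡ j
    embed-inj {i} {j} eq = Fin.inject≤-injective d<n d<n i j
      (≡.trans (≡.sym (strictlyInverseˡ _)) (≡.trans (to-cong eq) (strictlyInverseˡ _)))
    -- Here d = e + 2: constant term 0, linear coefficient -1, then `e` zeros below the implicit
    -- leading 1.
    X^d-X = 0# ∷ - 1# ∷ replicate e 0#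
    eval-X^ : ∀ m x → evalMonic (replicate m 0#) x ≈ x ^ m
    eval-X^ zero    x = refl
    eval-X^ (suc m) x = trans (+-identityʳ _) (*-congˡ (eval-X^ m x))
    root : ∀ i → evalMonic X^d-X (from (embed i)) ≈ 0#
    root i = begin
      x * (x * evalMonic (replicate e 0#) x + - 1#) + 0#  ≈⟨ +-identityʳ _ ⟩
      x * (x * evalMonic (replicate e 0#) x + - 1#)       ≈⟨ *-congˡ (+-congʳ (*-congˡ (eval-X^ e x))) ⟩
      x * (x * x ^ e - 1#)       ≈⟨ distribˡ _ _ _ ⟩
      x ^ suc (suc e) + x * - 1# ≈⟨ +-congˡ (trans (sym (-‿distribʳ-* x 1#)) (-‿cong (*-identityʳ x))) ⟩
      x ^ suc (suc e) - x        ≈⟨ x≈y⇒x∙y⁻¹≈ε (decidable-stable (x ^ suc (suc e) ≟ x) (λ x^d≉x → none (embed i , x^d≉x))) ⟩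
      0# ∎
      where x = from (embed i)

  -- Extended by the identity outside `P`, the map `g` stays injective because it sends `P` into
  -- `P`; by pigeonhole the extension is surjective. A preimage of `y` outside `P` would be `y`
  -- itself, which lies in `P`.
  injective-on⇒surjective-on : ∀ {s} {P : Pred Carrier s} → Unary.Decidable P → P Respects _≈_ →
    {g : Carrier → Carrier} → (∀ {x} → P x → P (g x)) →
    (∀ {x y} → P x → P y → g x ≈ g y → x ≈ y) → ∀ {y} → P y → ∃ λ x → P x × g x ≈ y
  injective-on⇒surjective-on {P = P} P? P-resp {g} maps inj {y} Py = preimage
    where
    ĝ : Carrier → Carrier
    ĝ x with P? x
    ... | yes _ = g x
    ... | no  _ = x

    ĝ-injective : ∀ {x z} → ĝ x ≈ ĝ z → x ≈ z
    ĝ-injective {x} {z} eq with P? x | P? z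
    ... | yes Px | yes Pz = inj Px Pz eq
    ... | yes Px | no ¬Pz = contradiction (P-resp eq (maps Px)) ¬Pz
    ... | no ¬Px | yes Pz = contradiction (P-resp (sym eq) (maps Pz)) ¬Px
    ... | no _   | no _   = eq

    ĝ-on-Fin-injective : Injective _≡_ _≡_ (to ∘ ĝ ∘ from)
    ĝ-on-Fin-injective {i} {j} eq = ≡.trans (≡.sym (strictlyInverseˡ i)) (≡.trans
      (to-cong (ĝ-injective (to-injective eq))) (strictlyInverseˡ j))

    preimage : ∃ λ x → P x × g x ≈ y
    preimage with i , ĝi≡y ← injective⇒surjective ĝ-on-Fin-injective (to y) with P? (from i)
    ... | yes Pi = from i , Pi , to-injective ĝi≡y
    ... | no ¬Pi = contradiction (P-resp (sym (to-injective ĝi≡y)) Py) ¬Pi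

-- Calculation in characteristic two.

HasCharTwo : ∀ {c ℓ} → CommutativeRing c ℓ → Set ℓ
HasCharTwo R = 1# + 1# ≈ 0#
  where open CommutativeRing R

module CharTwo {c ℓ} (R : CommutativeRing c ℓ) (1+1≈0 : HasCharTwo R) where
  open CommutativeRing R renaming (zero to *-zero)
  open RingProperties ring using (-0#≈0#; +-inverseʳ-unique)

  private
    -- With coefficients in the field of two elements the solver proves identities that hold only
    -- modulo 2.
    𝔽₂ : RawRing _ _
    𝔽₂ = record
      { Carrier = Bool ; _≈_ = _≡_ ; _+_ = _xor_ ; _*_ = _∧_ ; -_ = id ; 0# = false ; 1# = true }

    ⟦_⟧ : Bool → Carrier
    ⟦ false ⟧ = 0#
    ⟦ true ⟧  = 1#

    morphism : 𝔽₂ -Raw-AlmostCommutative⟶ fromCommutativeRing R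
    morphism = record
      { ⟦_⟧    = ⟦_⟧
      ; +-homo = λ where
          false b     → sym (+-identityˡ ⟦ b ⟧)
          true  false → sym (+-identityʳ 1#)
          true  true  → sym 1+1≈0
      ; *-homo = λ where
          false b → sym (zeroˡ ⟦ b ⟧)
          true  b → sym (*-identityˡ ⟦ b ⟧)
      ; -‿homo = λ where
          false → sym -0#≈0#
          true  → +-inverseʳ-unique 1# 1# 1+1≈0
      ; 0-homo = refl
      ; 1-homo = refl
      }

  open RingSolver 𝔽₂ (fromCommutativeRing R) morphism
    (λ a b → Maybe.map (λ eq → reflexive (≡.cong ⟦_⟧ eq)) (dec⇒maybe (a Bool.≟ b))) public
    using (solve; con; _:+_; _:*_; _:=_)

  x+x≈0 : ∀ x → x + x ≈ 0#
  x+x≈0 = solve 1 (λ x → x :+ x := con false) refl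

  -x≈x : ∀ x → - x ≈ x
  -x≈x x = sym (+-inverseʳ-unique x x (x+x≈0 x))

  x+y≈0⇒x≈y : ∀ {x y} → x + y ≈ 0# → x ≈ y
  x+y≈0⇒x≈y {x} {y} eq = trans (solve 2 (λ x y → x := (x :+ y) :+ y) refl x y) (trans (+-congʳ eq) (+-identityˡ y))

  x≈y⇒x+y≈0 : ∀ {x y} → x ≈ y → x + y ≈ 0#
  x≈y⇒x+y≈0 {x} {y} eq = trans (+-congʳ eq) (x+x≈0 y)

  infix  6.5 _·0_
  infixl 6 _+0_

  -- Together with `_+0_` this certifies linear combinations of vanishing terms: `solve` rewrites a
  -- goal as such a combination, and the certificate follows it summand by summand.
  _·0_ : ∀ a {x} → x ≈ 0# → a * x ≈ 0#
  a ·0 x≈0 = trans (*-congˡ x≈0) (zeroʳ a)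

  _+0_ : ∀ {x y} → x ≈ 0# → y ≈ 0# → x + y ≈ 0#
  x≈0 +0 y≈0 = trans (+-cong x≈0 y≈0) (+-identityˡ 0#)

-- Ring endomorphisms, and the pair abstracting the q-th and Q-th powers.

record IsEndomorphism {c ℓ} (R : CommutativeRing c ℓ)
  (φ : CommutativeRing.Carrier R → CommutativeRing.Carrier R) : Set (c ⊔ ℓ) where
  open CommutativeRing R
  field
    cong    : ∀ {x y} → x ≈ y → φ x ≈ φ y
    homo-+  : ∀ x y → φ (x + y) ≈ φ x + φ y
    homo-*  : ∀ x y → φ (x * y) ≈ φ x * φ y
    homo-0  : φ 0# ≈ 0#
    homo-1  : φ 1# ≈ 1#

  infixl 6 _⊕_
  infixl 7 _⊗_

  -- Together with `_⊗_` this evaluates `φ` on a polynomial expression by a proof term of the same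
  -- shape.
  _⊕_ : ∀ {x x′ y y′} → φ x ≈ x′ → φ y ≈ y′ → φ (x + y) ≈ x′ + y′
  φx≈x′ ⊕ φy≈y′ = trans (homo-+ _ _) (+-cong φx≈x′ φy≈y′)

  _⊗_ : ∀ {x x′ y y′} → φ x ≈ x′ → φ y ≈ y′ → φ (x * y) ≈ x′ * y′
  φx≈x′ ⊗ φy≈y′ = trans (homo-* _ _) (*-cong φx≈x′ φy≈y′)

  vanish : ∀ {x x′} → φ x ≈ x′ → x ≈ 0# → x′ ≈ 0#
  vanish φx≈x′ x≈0 = trans (sym φx≈x′) (trans (cong x≈0) homo-0)

-- Abstracts x ↦ x^q and x ↦ x^Q. With these maps `a * τ a` is a^(Q+1), and coprimality is what
-- provides `norm-injective`.
record NormInjectivePair {c ℓ} (R : CommutativeRing c ℓ)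
  (σ τ : CommutativeRing.Carrier R → CommutativeRing.Carrier R) : Set (c ⊔ ℓ) where
  open CommutativeRing R
  field
    σ-endo         : IsEndomorphism R σ
    τ-endo         : IsEndomorphism R τ
    στ-comm        : ∀ x → σ (τ x) ≈ τ (σ x)
    norm-injective : ∀ {a b} → σ a ≈ a → σ b ≈ b → a * τ a ≈ b * τ b → a ≈ b

-- Injectivity on Γ in characteristic two.

module Injectivity {c ℓ₁ ℓ₂} (F : HeytingField c ℓ₁ ℓ₂) {n} (enum : HasOrder F n)
  (1+1≈0 : HasCharTwo (commutativeRing F)) {σ τ : HeytingField.Carrier F → HeytingField.Carrier F}
  (pair : NormInjectivePair (commutativeRing F) σ τ) where

  open NormInjectivePair pair using (σ-endo; τ-endo; στ-comm; norm-injective)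
  open FiniteField F enum using (_≟_; 1≉0; inverse; xy≈0⇒y≈0; divide)
  open CommutativeRing (commutativeRing F) renaming (zero to *-zero)
  open CharTwo (commutativeRing F) 1+1≈0
  private
    module σ = IsEndomorphism σ-endo
    module τ = IsEndomorphism τ-endo

  endo-≉0 : ∀ {φ} → IsEndomorphism (commutativeRing F) φ → ∀ {x} → x ≉ 0# → φ x ≉ 0#
  endo-≉0 φ-endo {x} x≉0 φx≈0 with y , xy≈1 ← inverse x≉0 = 1≉0
    (trans (sym homo-1) (trans (cong (sym xy≈1)) (trans (homo-* x y) (trans (*-congʳ φx≈0) (zeroˡ _)))))
    where open IsEndomorphism φ-endo

  -- Applying `σ` to `a * d ≈ x` gives `σ a * d′ ≈ x′`; comparison with `a * d′ ≈ x′` and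
  -- cancellation of `d′` show that `a` is fixed.
  σ-quotient : ∀ {a d d′ x x′} → d ≉ 0# → a * d ≈ x → σ d ≈ d′ → σ x ≈ x′ → a * d′ ≈ x′ → σ a ≈ a
  σ-quotient {a} {d} {d′} {x} {x′} d≉0 ad≈x σd≈d′ σx≈x′ ad′≈x′ = x+y≈0⇒x≈y (xy≈0⇒y≈0
    (λ d′≈0 → endo-≉0 σ-endo d≉0 (trans σd≈d′ d′≈0))
    (trans (solve 3 (λ a b d → d :* (a :+ b) := a :* d :+ b :* d) refl (σ a) a d′)
      (x≈y⇒x+y≈0 (trans (*-congˡ (sym σd≈d′)) (trans (sym (σ.homo-* a d)) (trans (σ.cong ad≈x) (trans σx≈x′ (sym ad′≈x′))))))))

  -- The elements `a * τ a` and `(a + 1#) * τ (a + 1#)` differ by `τ a + a + 1#`; if that vanished,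
  -- `norm-injective` would identify `a` with `a + 1#`.
  no-unit-shift : ∀ {a} → σ a ≈ a → τ a + a + 1# ≉ 0#
  no-unit-shift {a} σa≈a eq = 1≉0 (trans (solve 1 (λ a → con true := a :+ (a :+ con true)) refl a)
    (x≈y⇒x+y≈0 (norm-injective σa≈a (σa≈a σ.⊕ σ.homo-1) (x+y≈0⇒x≈y
      (trans (+-congˡ (*-congˡ (refl τ.⊕ τ.homo-1)))
        (trans (solve 2 (λ a b → a :* b :+ (a :+ con true) :* (b :+ con true) := b :+ a :+ con true) refl a (τ a)) eq))))))

  -- τ w is w or w + 1, as both are the roots of X² + X + 1; the latter would give w τ w = 1 = 1 τ 1.
  τ-fixes-ω : ∀ {w} → σ w ≈ w → w * w + w + 1# ≈ 0# → τ w ≈ w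
  τ-fixes-ω {w} σw≈w w²+w+1≈0 = decidable-stable (τ w ≟ w) λ τw≉w →
    let
      τw+w+1≈0 : τ w + w + 1# ≈ 0#
      τw+w+1≈0 = xy≈0⇒y≈0 (λ eq → τw≉w (x+y≈0⇒x≈y eq)) (trans
        (solve 2 (λ w v → (v :+ w) :* (v :+ w :+ con true) := (v :* v :+ v :+ con true) :+ (w :* w :+ w :+ con true)) refl w (τ w))
        (τ.vanish (refl τ.⊗ refl τ.⊕ refl τ.⊕ τ.homo-1) w²+w+1≈0 +0 w²+w+1≈0))
    in no-unit-shift σw≈w τw+w+1≈0

  -- Membership in Γ when `σ` is the q-th power map.
  TraceZero : Carrier → Set ℓ₁
  TraceZero x = σ (σ x) + σ x + x ≈ 0#

  module _ {x h} (x∈Γ : TraceZero x) (h∈Γ : TraceZero h) (h≉0 : h ≉ 0#) where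
    private
      y = σ x ; u = σ h
      X = τ x ; Y = τ y ; H = τ h ; U = τ u
      -- The determinant of the matrix with rows `h`, `u` and `σ h`, `σ u`, since σ u = h + u.
      D  = h * h + h * u + u * u
      -- E₁ = f(h) and E₂ = σ²(E₁).
      E₁ = h * H + u * U
      E₂ = U * h + u * H + u * U

      -- In characteristic two, trace zero reads σ(σ x) = x + σ x, so `σ` acts on the pairs `x`, `y`
      -- and `h`, `u` by the same matrix.
      σy : σ y ≈ x + y
      σy = x+y≈0⇒x≈y (trans (solve 3 (λ x y z → z :+ (x :+ y) := z :+ y :+ x) refl x y (σ y)) x∈Γ)
      σu : σ u ≈ h + u
      σu = x+y≈0⇒x≈y (trans (solve 3 (λ x y z → z :+ (x :+ y) := z :+ y :+ x) refl h u (σ u)) h∈Γ)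
      σH : σ H ≈ U
      σH = στ-comm h
      σU : σ U ≈ H + U
      σU = trans (στ-comm u) (trans (τ.cong σu) (τ.homo-+ h u))
      σE₁ : σ E₁ ≈ u * U + (h + u) * (H + U)
      σE₁ = refl σ.⊗ σH σ.⊕ σu σ.⊗ σU
      σE₂ : σ E₂ ≈ (H + U) * u + (h + u) * U + (h + u) * (H + U)
      σE₂ = σU σ.⊗ refl σ.⊕ σu σ.⊗ σH σ.⊕ σu σ.⊗ σU
      H≉0 : H ≉ 0#
      H≉0 = endo-≉0 τ-endo h≉0

    -- The equation f(x + h) = f(x), up to sign.
    Collision : Set ℓ₁
    Collision = Y * u + y * U + u * U + (X * h + x * H + h * H) ≈ 0#

    -- For `w` = u / h the hypothesis reads w^2 + w + 1 = 0, and `w` is fixed by `σ` and by `τ`. The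
    -- fixed point to which `no-unit-shift` applies is `α` = (x + w y) / u.
    ¬collision-D≈0 : D ≈ 0# → ¬ Collision
    ¬collision-D≈0 D≈0 collision = no-unit-shift σα≈α (xy≈0⇒y≈0 w≉0 (xy≈0⇒y≈0 H≉0 (xy≈0⇒y≈0 h≉0 (trans
      -- The right side is the collision expression plus multiples of the relations defining `w` and
      -- `α`, of their images under `τ`, and of w^2 + w + 1.
      (solve 11 (λ h u H U x y X Y w α a →
        h :* (H :* (w :* (a :+ α :+ con true)))
        := H :* α :* (w :* h :+ u) :+ H :* (α :* u :+ (x :+ w :* y))
           :+ h :* a :* (U :+ w :* H) :+ h :* (a :* U :+ (X :+ w :* Y))
           :+ (Y :* u :+ y :* U :+ u :* U :+ (X :* h :+ x :* H :+ h :* H))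
           :+ (Y :+ U) :* (w :* h :+ u) :+ (y :+ w :* h) :* (U :+ w :* H)
           :+ h :* H :* (w :* w :+ w :+ con true)) refl h u H U x y X Y w α (τ α))
      (H * α ·0 wh+u≈0 +0 H ·0 x≈y⇒x+y≈0 αu≈x+wy
        +0 h * τ α ·0 U+wH≈0 +0 h ·0 x≈y⇒x+y≈0 τα*U
        +0 collision
        +0 (Y + U) ·0 wh+u≈0 +0 (y + w * h) ·0 U+wH≈0
        +0 h * H ·0 W)))))
      where
      w = proj₁ (divide h≉0 u)
      wh≈u = proj₂ (divide h≉0 u)
      wh+u≈0 : w * h + u ≈ 0#
      wh+u≈0 = x≈y⇒x+y≈0 wh≈u

      W : w * w + w + 1# ≈ 0#
      W = xy≈0⇒y≈0 h≉0 (xy≈0⇒y≈0 h≉0 (trans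
        (solve 3 (λ h u w → h :* (h :* (w :* w :+ w :+ con true))
          := (h :* h :+ h :* u :+ u :* u) :+ (u :+ w :* h :+ h) :* (w :* h :+ u)) refl h u w)
        (D≈0 +0 (u + w * h + h) ·0 wh+u≈0)))

      w≉0 : w ≉ 0#
      w≉0 w≈0 = 1≉0 (trans
        (solve 1 (λ w → con true := (w :* w :+ w :+ con true) :+ (w :+ con true) :* w) refl w)
        (W +0 (w + 1#) ·0 w≈0))

      u≉0 : u ≉ 0#
      u≉0 = endo-≉0 σ-endo h≉0

      wu≈h+u : w * u ≈ h + u
      wu≈h+u = x+y≈0⇒x≈y (trans
        (solve 3 (λ h u w → w :* u :+ (h :+ u)
          := h :* (w :* w :+ w :+ con true) :+ (w :+ con true) :* (w :* h :+ u)) refl h u w)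
        (h ·0 W +0 (w + 1#) ·0 wh+u≈0))

      σw≈w : σ w ≈ w
      σw≈w = σ-quotient h≉0 wh≈u refl σu wu≈h+u

      τw≈w : τ w ≈ w
      τw≈w = τ-fixes-ω σw≈w W

      U+wH≈0 : U + w * H ≈ 0#
      U+wH≈0 = x≈y⇒x+y≈0 (trans (τ.cong (sym wh≈u)) (τw≈w τ.⊗ refl))

      -- Both `u` and `x + w * y` are eigenvectors of `σ` with eigenvalue `w`, so their quotient is
      -- fixed.
      α = proj₁ (divide u≉0 (x + w * y))
      αu≈x+wy = proj₂ (divide u≉0 (x + w * y))

      σα≈α : σ α ≈ α
      σα≈α = σ-quotient u≉0 αu≈x+wy σu (refl σ.⊕ σw≈w σ.⊗ σy) (x+y≈0⇒x≈y (trans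
        (solve 6 (λ h u x y w α → α :* (h :+ u) :+ (y :+ w :* (x :+ y))
          := α :* (w :* u :+ (h :+ u)) :+ w :* (α :* u :+ (x :+ w :* y)) :+ y :* (w :* w :+ w :+ con true)) refl h u x y w α)
        (α ·0 x≈y⇒x+y≈0 wu≈h+u +0 w ·0 x≈y⇒x+y≈0 αu≈x+wy +0 y ·0 W)))

      τα*U : τ α * U ≈ X + w * Y
      τα*U = trans (sym (τ.homo-* α u)) (trans (τ.cong αu≈x+wy) (refl τ.⊕ τw≈w τ.⊗ refl))

    -- As linear forms in `H` and `U`, `E₁` and `σ E₁` have determinant `D`. If both vanished,
    -- eliminating `U` would leave `H * D ≈ 0#` with `H` nonzero.
    E₁≉0 : D ≉ 0# → E₁ ≉ 0#
    E₁≉0 D≉0 E₁≈0 = D≉0 (xy≈0⇒y≈0 H≉0 (trans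
      (solve 4 (λ h u H U → H :* (h :* h :+ h :* u :+ u :* u)
        := u :* ((h :* H :+ u :* U) :+ (u :* U :+ (h :+ u) :* (H :+ U))) :+ (h :+ u) :* (h :* H :+ u :* U)) refl h u H U)
      (u ·0 (E₁≈0 +0 σ.vanish σE₁ E₁≈0) +0 (h + u) ·0 E₁≈0)))

    -- A relation E₂ = κ E₁ makes κ a primitive cube root of unity in the fixed field of both σ and τ,
    -- and then h is an eigenvector of σ.
    E₁E₂-independent : D ≉ 0# → ∀ {κ} → σ κ ≈ κ → κ * E₁ + E₂ ≉ 0#
    E₁E₂-independent D≉0 {κ} σκ≈κ κE₁+E₂≈0 = endo-≉0 τ-endo z≉0 (xy≈0⇒y≈0 z≉0 (trans
      (*-congˡ (refl τ.⊕ (τκ≈κ τ.⊕ τ.homo-1) τ.⊗ refl))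
      (trans
        (solve 5 (λ h u H U κ → (h :+ (κ :+ con true) :* u) :* (H :+ (κ :+ con true) :* U)
          := (κ :+ con true) :* (κ :* (h :* H :+ u :* U) :+ (U :* h :+ u :* H :+ u :* U))
             :+ h :* H :* (κ :* κ :+ κ :+ con true)) refl h u H U κ)
        ((κ + 1#) ·0 κE₁+E₂≈0 +0 h * H ·0 K))))
      where
      -- Since σ E₁ = E₁ + E₂ and σ E₂ = E₁, the image of the relation under `σ` plus `κ` times the
      -- relation is E₁ (κ^2 + κ + 1).
      K : κ * κ + κ + 1# ≈ 0#
      K = xy≈0⇒y≈0 (E₁≉0 D≉0) (trans
        (solve 5 (λ h u H U κ → (h :* H :+ u :* U) :* (κ :* κ :+ κ :+ con true)
          := (κ :* (u :* U :+ (h :+ u) :* (H :+ U)) :+ ((H :+ U) :* u :+ (h :+ u) :* U :+ (h :+ u) :* (H :+ U)))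
             :+ κ :* (κ :* (h :* H :+ u :* U) :+ (U :* h :+ u :* H :+ u :* U))) refl h u H U κ)
        (σ.vanish (σκ≈κ σ.⊗ σE₁ σ.⊕ σE₂) κE₁+E₂≈0 +0 κ ·0 κE₁+E₂≈0))
      τκ≈κ : τ κ ≈ κ
      τκ≈κ = τ-fixes-ω σκ≈κ K
      -- By `K`, `D` factors as (h + κ u) z, so `z` is nonzero; yet the relation makes `z * τ z`
      -- vanish.
      z = h + (κ + 1#) * u
      z≉0 : z ≉ 0#
      z≉0 z≈0 = D≉0 (trans
        (solve 3 (λ h u κ → h :* h :+ h :* u :+ u :* u
          := (h :+ κ :* u) :* (h :+ (κ :+ con true) :* u) :+ u :* u :* (κ :* κ :+ κ :+ con true)) refl h u κ)
        ((h + κ * u) ·0 z≈0 +0 u * u ·0 K))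

    -- Here h and u are a basis of Γ over the fixed field of σ, and α, β are the coordinates of x.
    ¬collision-D≉0 : D ≉ 0# → ¬ Collision
    ¬collision-D≉0 D≉0 collision = no-unit-shift σα≈α (xy≈0⇒y≈0 (E₁≉0 D≉0)
      (trans (solve 3 (λ e d b → e := (e :+ d :* b) :+ d :* b) refl (E₁ * A) E₂ B) (relation +0 E₂ ·0 B≈0)))
      where
      -- Cramer's rule for x = α h + β u and y = α u + β (h + u).
      α = proj₁ (divide D≉0 (x * (h + u) + y * u))
      αD≈ = proj₂ (divide D≉0 (x * (h + u) + y * u))
      β = proj₁ (divide D≉0 (x * u + y * h))
      βD≈ = proj₂ (divide D≉0 (x * u + y * h))
      A = τ α + α + 1#
      B = τ β + β

      σD≈D : σ D ≈ D
      σD≈D = trans (refl σ.⊗ refl σ.⊕ refl σ.⊗ σu σ.⊕ σu σ.⊗ σu)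
        (solve 2 (λ h u → u :* u :+ u :* (h :+ u) :+ (h :+ u) :* (h :+ u) := h :* h :+ h :* u :+ u :* u) refl h u)

      σα≈α : σ α ≈ α
      σα≈α = σ-quotient D≉0 αD≈ σD≈D (refl σ.⊗ (refl σ.⊕ σu) σ.⊕ σy σ.⊗ σu) (trans αD≈
        (solve 4 (λ h u x y → x :* (h :+ u) :+ y :* u := y :* (u :+ (h :+ u)) :+ (x :+ y) :* (h :+ u)) refl h u x y))

      σβ≈β : σ β ≈ β
      σβ≈β = σ-quotient D≉0 βD≈ σD≈D (refl σ.⊗ σu σ.⊕ σy σ.⊗ refl) (trans βD≈
        (solve 4 (λ h u x y → x :* u :+ y :* h := y :* (h :+ u) :+ (x :+ y) :* u) refl h u x y))

      x≈ : x ≈ α * h + β * u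
      x≈ = x+y≈0⇒x≈y (xy≈0⇒y≈0 D≉0 (trans
        (solve 6 (λ h u x y α β →
          let D = h :* h :+ h :* u :+ u :* u in
          D :* (x :+ (α :* h :+ β :* u))
          := h :* (α :* D :+ (x :* (h :+ u) :+ y :* u)) :+ u :* (β :* D :+ (x :* u :+ y :* h))) refl h u x y α β)
        (h ·0 x≈y⇒x+y≈0 αD≈ +0 u ·0 x≈y⇒x+y≈0 βD≈)))

      y≈ : y ≈ α * u + β * (h + u)
      y≈ = trans (σ.cong x≈) (σα≈α σ.⊗ refl σ.⊕ σβ≈β σ.⊗ σu)

      X≈ : X ≈ τ α * H + τ β * U
      X≈ = trans (τ.cong x≈) (refl τ.⊗ refl τ.⊕ refl τ.⊗ refl)

      Y≈ : Y ≈ τ α * U + τ β * (H + U)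
      Y≈ = trans (τ.cong y≈) (refl τ.⊗ refl τ.⊕ refl τ.⊗ (refl τ.⊕ refl))

      -- In these coordinates the collision becomes a linear relation between `E₁` and `E₂` with
      -- coefficients fixed by `σ`.
      relation : E₁ * A + E₂ * B ≈ 0#
      relation = trans
        (solve 12 (λ h u H U x y X Y α β a b →
          (h :* H :+ u :* U) :* (a :+ α :+ con true) :+ (U :* h :+ u :* H :+ u :* U) :* (b :+ β)
          := (Y :* u :+ y :* U :+ u :* U :+ (X :* h :+ x :* H :+ h :* H))
             :+ u :* (Y :+ (a :* U :+ b :* (H :+ U))) :+ U :* (y :+ (α :* u :+ β :* (h :+ u)))
             :+ h :* (X :+ (a :* H :+ b :* U)) :+ H :* (x :+ (α :* h :+ β :* u)))
          refl h u H U x y X Y α β (τ α) (τ β))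
        (collision +0 u ·0 x≈y⇒x+y≈0 Y≈ +0 U ·0 x≈y⇒x+y≈0 y≈ +0 h ·0 x≈y⇒x+y≈0 X≈ +0 H ·0 x≈y⇒x+y≈0 x≈)

      σA≈A : σ A ≈ A
      σA≈A = trans (στ-comm α) (τ.cong σα≈α) σ.⊕ σα≈α σ.⊕ σ.homo-1

      σB≈B : σ B ≈ B
      σB≈B = trans (στ-comm β) (τ.cong σβ≈β) σ.⊕ σβ≈β

      -- Otherwise κ = A / B would be a fixed element with κ E₁ + E₂ = 0. Once `B` vanishes, so does
      -- `E₁ * A`, and hence `A`.
      B≈0 : B ≈ 0#
      B≈0 = decidable-stable (B ≟ 0#) λ B≉0 →
        let κ , κB≈A = divide B≉0 A in
        E₁E₂-independent D≉0 (σ-quotient B≉0 κB≈A σB≈B σA≈A κB≈A) (xy≈0⇒y≈0 B≉0 (trans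
          (solve 5 (λ A B e d κ → B :* (κ :* e :+ d) := e :* (κ :* B :+ A) :+ (e :* A :+ d :* B)) refl A B E₁ E₂ κ)
          (E₁ ·0 x≈y⇒x+y≈0 κB≈A +0 relation)))

    ¬collision : ¬ Collision
    ¬collision with D ≟ 0#
    ... | yes D≈0 = ¬collision-D≈0 D≈0
    ... | no  D≉0 = ¬collision-D≉0 D≉0

  -- For `h` = x + z, again of trace zero, the collision expression expands to the sum of the two
  -- sides of the equation.
  difference-injective : ∀ {x z} → TraceZero x → TraceZero z →
    σ (x * τ x) + x * τ x ≈ σ (z * τ z) + z * τ z → x ≈ z
  difference-injective {x} {z} x∈Γ z∈Γ eq = decidable-stable (x ≟ z) λ x≉z →
    ¬collision x∈Γ x+z∈Γ (λ x+z≈0 → x≉z (x+y≈0⇒x≈y x+z≈0)) (begin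
      Y * σ h + y * τ (σ h) + σ h * τ (σ h) + (X * h + x * τ h + h * τ h)
        ≈⟨ +-cong (+-cong (+-cong (*-congˡ σh) (*-congˡ τσh)) (*-cong σh τσh))
                  (+-cong (+-congˡ (*-congˡ τh)) (*-congˡ τh)) ⟩
      Y * (y + y′) + y * (Y + Y′) + (y + y′) * (Y + Y′) + (X * h + x * (X + Z) + h * (X + Z))
        ≈⟨ solve 8 (λ x y z y′ X Y Z Y′ →
             Y :* (y :+ y′) :+ y :* (Y :+ Y′) :+ (y :+ y′) :* (Y :+ Y′)
               :+ (X :* (x :+ z) :+ x :* (X :+ Z) :+ (x :+ z) :* (X :+ Z))
             := (y :* Y :+ x :* X) :+ (y′ :* Y′ :+ z :* Z)) refl x y z y′ X Y Z Y′ ⟩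
      (y * Y + x * X) + (y′ * Y′ + z * Z)
        ≈⟨ +-cong (+-congʳ (refl σ.⊗ στ-comm x)) (+-congʳ (refl σ.⊗ στ-comm z)) ⟨
      (σ (x * X) + x * X) + (σ (z * Z) + z * Z)
        ≈⟨ x≈y⇒x+y≈0 eq ⟩
      0# ∎)
    where
    open SetoidReasoning setoid
    y = σ x ; y′ = σ z ; X = τ x ; Y = τ y ; Z = τ z ; Y′ = τ y′
    h = x + z
    σh : σ h ≈ y + y′
    σh = σ.homo-+ x z
    τh : τ h ≈ X + Z
    τh = τ.homo-+ x z
    τσh : τ (σ h) ≈ Y + Y′
    τσh = trans (τ.cong σh) (τ.homo-+ y y′)
    x+z∈Γ : TraceZero h
    x+z∈Γ = trans (+-congʳ (+-cong (trans (σ.cong σh) (σ.homo-+ y y′)) σh)) (trans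
      (solve 6 (λ a b c d e f → a :+ b :+ (c :+ d) :+ (e :+ f) := (a :+ c :+ e) :+ (b :+ d :+ f)) refl (σ y) (σ y′) y y′ x z)
      (x∈Γ +0 z∈Γ))

-- The field of order q^3: permuting Γ is equivalent to coprimality.

module Permutation {c ℓ₁ ℓ₂} {p k : ℕ} (ℓ : ℕ) (p-prime : Prime p) (k>0 : 0 ℕ.< k)
  (F : HeytingField c ℓ₁ ℓ₂) (ord : HasOrder F ((p ℕ.^ k) ℕ.^ 3)) where

  private
    q = p ℕ.^ k
    Q = p ℕ.^ ℓ

  open NumberTheory using (a∸1∣a^n∸1; coprime⇒p≡2)
  open FiniteField F ord
  open CommutativeRing (commutativeRing F) renaming (zero to *-zero)
  open Frobenius (commutativeRing F)
  open Exp commutativeSemiring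
  open Mult semiring using () renaming (_×_ to _·_)
  open RingProperties ring using (+-inverseʳ-unique; x≈y⇒x∙y⁻¹≈ε; x∙y⁻¹≈ε⇒x≈y)
  open SetoidReasoning setoid

  p·1≈0 : p · 1# ≈ 0#
  p·1≈0 = p^e≡n⇒p·1≈0 (k ℕ.* 3) (≡.sym (ℕ.^-*-assoc p k 3))

  frobenius : ∀ e → IsEndomorphism (commutativeRing F) (_^ (p ℕ.^ e))
  frobenius e = record
    { cong = ^-congˡ (p ℕ.^ e)
    ; homo-+ = ^p^-homo-+ p-prime p·1≈0 e
    ; homo-* = λ x y → ^-distrib-* x y (p ℕ.^ e)
    ; homo-0 = 0^≈0 (p ℕ.^ e) {{ℕ.m^n≢0 p e {{prime⇒nonZero p-prime}}}}
    ; homo-1 = 1^≈1 (p ℕ.^ e)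
    }

  σ : Carrier → Carrier
  σ = _^ q
  module σ = IsEndomorphism (frobenius k)

  σσ : ∀ x → σ (σ x) ≈ x ^ (q ℕ.^ 2)
  σσ x = trans (^-assocʳ x q q) (^-congʳ x (≡.cong (q ℕ.*_) (≡.sym (ℕ.*-identityʳ q))))

  σσσ : ∀ x → σ (σ (σ x)) ≈ x
  σσσ x = begin
    σ (σ (σ x))      ≈⟨ σσ (σ x) ⟩
    (x ^ q) ^ (q ℕ.^ 2) ≈⟨ ^-assocʳ x q (q ℕ.^ 2) ⟩
    x ^ (q ℕ.^ 3)    ≈⟨ x^n≈x x ⟩
    x                ∎

  σ-neg : ∀ x → σ (- x) ≈ - σ x
  σ-neg x = +-inverseʳ-unique (σ x) (σ (- x)) (σ.vanish (σ.homo-+ x (- x)) (-‿inverseʳ x))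

  σ-sub : ∀ x y → σ (x - y) ≈ σ x - σ y
  σ-sub x y = trans (σ.homo-+ x (- y)) (+-congˡ (σ-neg y))

  trace≈0⇒Γ : ∀ {x} → σ (σ x) + σ x + x ≈ 0# → Γ F q x
  trace≈0⇒Γ {x} = trans (+-congʳ (+-congʳ (sym (σσ x))))

  Γ⇒trace≈0 : ∀ {x} → Γ F q x → σ (σ x) + σ x + x ≈ 0#
  Γ⇒trace≈0 {x} = trans (+-congʳ (+-congʳ (σσ x)))

  Γ-resp : ∀ {x y} → x ≈ y → Γ F q x → Γ F q y
  Γ-resp x≈y = trans (sym (+-cong (+-cong (^-congˡ (q ℕ.^ 2) x≈y) (^-congˡ q x≈y)) x≈y))

  telescope : ∀ a b c → (a - b) + (b - c) ≈ a - c
  telescope a b c = begin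
    (a - b) + (b - c) ≈⟨ +-assoc a (- b) (b - c) ⟩
    a + (- b + (b - c)) ≈⟨ +-congˡ (+-assoc (- b) b (- c)) ⟨
    a + ((- b + b) - c) ≈⟨ +-congˡ (trans (+-congʳ (-‿inverseˡ b)) (+-identityˡ (- c))) ⟩
    a - c ∎

  -- The sum of the three conjugates telescopes because the third iterate of `σ` is the identity.
  σx-x∈Γ : ∀ x → Γ F q (σ x - x)
  σx-x∈Γ x = trace≈0⇒Γ (begin
    σ (σ (σ x - x)) + σ (σ x - x) + (σ x - x)
      ≈⟨ +-congʳ (+-cong (trans (σ.cong (σ-sub (σ x) x)) (trans (σ-sub _ _) (+-congʳ (σσσ x)))) (σ-sub (σ x) x)) ⟩
    (x - σ (σ x)) + (σ (σ x) - σ x) + (σ x - x)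
      ≈⟨ trans (+-congʳ (telescope x (σ (σ x)) (σ x))) (telescope x (σ x) x) ⟩
    x - x
      ≈⟨ -‿inverseʳ x ⟩
    0# ∎)

  f∈Γ : ∀ x → Γ F q (f F q Q x)
  f∈Γ x = σx-x∈Γ (x ^ (Q ℕ.+ 1))

  f-cong : ∀ {x y} → x ≈ y → f F q Q x ≈ f F q Q y
  f-cong x≈y = +-cong (^-congˡ q (^-congˡ (Q ℕ.+ 1) x≈y)) (-‿cong (^-congˡ (Q ℕ.+ 1) x≈y))

  2≤q : 2 ℕ.≤ q
  2≤q = ℕ.≤-trans (ℕ.nonTrivial⇒n>1 p {{prime⇒nonTrivial p-prime}})
    (≡.subst (ℕ._≤ q) (ℕ.*-identityʳ p) (ℕ.^-monoʳ-≤ p {{prime⇒nonZero p-prime}} k>0))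

  q<q^3 : q ℕ.< q ℕ.^ 3
  q<q^3 = ≡.subst (ℕ._< q ℕ.^ 3) (ℕ.*-identityʳ q) (ℕ.^-monoʳ-< q 2≤q {1} {3} (ℕ.s≤s (ℕ.s≤s ℕ.z≤n)))

  ^∣-≈1 : ∀ {x m n} → m ∣ n → x ^ m ≈ 1# → x ^ n ≈ 1#
  ^∣-≈1 {x} {m} {n} (divides t n≡tm) x^m≈1 = begin
    x ^ n         ≈⟨ ^-congʳ x (≡.trans n≡tm (ℕ.*-comm t m)) ⟩
    x ^ (m ℕ.* t) ≈⟨ ^-assocʳ x m t ⟨
    (x ^ m) ^ t   ≈⟨ ^-congˡ t x^m≈1 ⟩
    1# ^ t        ≈⟨ 1^≈1 t ⟩
    1#            ∎

  *x^[n∸1] : ∀ x {n} → 0 ℕ.< n → x * x ^ (n ∸ 1) ≈ x ^ n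
  *x^[n∸1] x {suc n} _ = refl

  q>0 : 0 ℕ.< q
  q>0 = ℕ.<-trans (ℕ.s≤s ℕ.z≤n) 2≤q

  -- Write q^3 - 1 = m g. As g > 1, m + 1 is less than q^3, so some `y` has y^(m+1) different from
  -- `y`; then `y ^ m` is not 1, while its g-th power is y^(q^3-1) = 1.
  ∃root-of-unity : ∀ {g} → 1 ℕ.< g → g ∣ q ℕ.^ 3 ∸ 1 → ∃ λ ζ → ζ ^ g ≈ 1# × ζ ≉ 1#
  ∃root-of-unity {g} 1<g (divides zero q³-1≡0) =
    contradiction (ℕ.m∸n≡0⇒m≤n q³-1≡0) (ℕ.<⇒≱ (ℕ.<-trans 2≤q q<q^3))
  ∃root-of-unity {g} 1<g (divides m@(suc _) q³-1≡mg) = y ^ m , y^m^g≈1 , y^m≉1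
    where
    q³≡ : suc (m ℕ.* g) ≡ q ℕ.^ 3
    q³≡ = ≡.trans (≡.cong suc (≡.sym q³-1≡mg)) (ℕ.m+[n∸m]≡n (ℕ.<-trans q>0 q<q^3))
    m+1<q³ : suc m ℕ.< q ℕ.^ 3
    m+1<q³ = ≡.subst (suc m ℕ.<_) q³≡ (ℕ.s≤s (ℕ.m<m*n m g 1<g))
    ∃y = ∃x^d≉x (suc m) (ℕ.s≤s (ℕ.s≤s ℕ.z≤n)) m+1<q³
    y = proj₁ ∃y
    y^[m+1]≉y = proj₂ ∃y
    y≉0 : y ≉ 0#
    y≉0 y≈0 = y^[m+1]≉y (trans (*-congʳ y≈0) (trans (zeroˡ _) (sym y≈0)))
    y^m^g≈1 : (y ^ m) ^ g ≈ 1#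
    y^m^g≈1 = trans (^-assocʳ y m g) (*-cancelˡ y≉0 (trans (^-congʳ y q³≡) (trans (x^n≈x y) (sym (*-identityʳ y)))))
    y^m≉1 : y ^ m ≉ 1#
    y^m≉1 y^m≈1 = y^[m+1]≉y (trans (*-congˡ y^m≈1) (*-identityʳ y))

  ∃nonzero∈Γ : ∃ λ x → Γ F q x × x ≉ 0#
  ∃nonzero∈Γ with y , y^q≉y ← ∃x^d≉x q 2≤q q<q^3 = σ y - y , σx-x∈Γ y , y^q≉y ∘ x∙y⁻¹≈ε⇒x≈y _ _

  permutes⇒coprime : Permutes F (f F q Q) (Γ F q) → gcd (q ∸ 1) (Q ℕ.+ 1) ≡ 1
  permutes⇒coprime (_ , f-injective , _) = decidable-stable (g ℕ.≟ 1) λ g≢1 →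
    let
      -- `g` divides q - 1 and hence q^3 - 1. Its dividing q - 1 makes `ζ` fixed by `σ`, and its
      -- dividing Q + 1 makes ζ^(Q+1) trivial.
      ζ , ζ^g≈1 , ζ≉1 = ∃root-of-unity (ℕ.≤∧≢⇒< g>0 (g≢1 ∘ ≡.sym)) (∣-trans g∣q-1 (a∸1∣a^n∸1 q 3))
      x , x∈Γ , x≉0   = ∃nonzero∈Γ
      σζ≈ζ : σ ζ ≈ ζ
      σζ≈ζ = trans (sym (*x^[n∸1] ζ q>0)) (trans (*-congˡ (^∣-≈1 g∣q-1 ζ^g≈1)) (*-identityʳ ζ))
      ζx^[Q+1] : (ζ * x) ^ (Q ℕ.+ 1) ≈ x ^ (Q ℕ.+ 1)
      ζx^[Q+1] = trans (^-distrib-* ζ x (Q ℕ.+ 1)) (trans (*-congʳ (^∣-≈1 g∣Q+1 ζ^g≈1)) (*-identityˡ _))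
      σζx : ∀ {x x′} → σ x ≈ x′ → σ (ζ * x) ≈ ζ * x′
      σζx σx≈x′ = σζ≈ζ σ.⊗ σx≈x′
      ζx∈Γ : Γ F q (ζ * x)
      ζx∈Γ = trace≈0⇒Γ (begin
        σ (σ (ζ * x)) + σ (ζ * x) + ζ * x    ≈⟨ +-congʳ (+-cong (trans (σ.cong (σζx refl)) (σζx refl)) (σζx refl)) ⟩
        ζ * σ (σ x) + ζ * σ x + ζ * x        ≈⟨ trans (distribˡ ζ _ x) (+-congʳ (distribˡ ζ _ _)) ⟨
        ζ * (σ (σ x) + σ x + x)              ≈⟨ trans (*-congˡ (Γ⇒trace≈0 x∈Γ)) (zeroʳ ζ) ⟩
        0#                                   ∎)
      ζx≈x : ζ * x ≈ x
      ζx≈x = f-injective {ζ * x , ζx∈Γ} {x , x∈Γ} (+-cong (σ.cong ζx^[Q+1]) (-‿cong ζx^[Q+1]))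
    in ζ≉1 (*-cancelˡ x≉0 (trans (*-comm x ζ) (trans ζx≈x (sym (*-identityʳ x)))))
    where
    g = gcd (q ∸ 1) (Q ℕ.+ 1)
    g∣q-1 = gcd[m,n]∣m (q ∸ 1) (Q ℕ.+ 1)
    g∣Q+1 = gcd[m,n]∣n (q ∸ 1) (Q ℕ.+ 1)
    g>0 : 0 ℕ.< g
    g>0 = ℕ.n≢0⇒n>0 λ g≡0 → contradiction (≡.trans (≡.sym (ℕ.+-comm Q 1)) (gcd[m,n]≡0⇒n≡0 (q ∸ 1) g≡0)) λ ()

  x*x^Q : ∀ x → x * x ^ Q ≈ x ^ (Q ℕ.+ 1)
  x*x^Q x = ^-congʳ x (ℕ.+-comm 1 Q)

  -- Bézout's identity in the natural numbers provides consecutive multiples of two coprime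
  -- exponents.
  ^-consecutive-≈1 : ∀ {m n i x} → m ∣ i → n ∣ suc i → x ^ m ≈ 1# → x ^ n ≈ 1# → x ≈ 1#
  ^-consecutive-≈1 {i = i} {x} m∣i n∣1+i x^m≈1 x^n≈1 = begin
    x          ≈⟨ *-identityʳ x ⟨
    x * 1#     ≈⟨ *-congˡ (^∣-≈1 m∣i x^m≈1) ⟨
    x ^ suc i  ≈⟨ ^∣-≈1 n∣1+i x^n≈1 ⟩
    1#         ∎

  ^-coprime-≈1 : ∀ m n {x} → gcd m n ≡ 1 → x ^ m ≈ 1# → x ^ n ≈ 1# → x ≈ 1#
  ^-coprime-≈1 m n gcd≡1 x^m≈1 x^n≈1 with coprime-Bézout {m} {n} (gcd≡1⇒coprime gcd≡1)
  ... | Bézout.+- a b 1+bn≡am = ^-consecutive-≈1 {n} {m} (divides b ≡.refl) (divides a 1+bn≡am) x^n≈1 x^m≈1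
  ... | Bézout.-+ a b 1+am≡bn = ^-consecutive-≈1 {m} {n} (divides a ≡.refl) (divides b 1+am≡bn) x^m≈1 x^n≈1

  module _ (gcd≡1 : gcd (q ∸ 1) (Q ℕ.+ 1) ≡ 1) where

    -- For nonzero `a` and `b` the quotient `r` = a / b satisfies r^(q-1) = 1, as both are fixed by
    -- `σ`, and r^(Q+1) = 1 by the equation; coprimality gives r = 1.
    norm-injective : ∀ {a b} → σ a ≈ a → σ b ≈ b → a * a ^ Q ≈ b * b ^ Q → a ≈ b
    norm-injective {a} {b} σa≈a σb≈b eq with b ≟ 0#
    ... | yes b≈0 = trans (decidable-stable (a ≟ 0#) λ a≉0 →
            ^≉0 (suc Q) a≉0 (trans eq (trans (*-congʳ b≈0) (zeroˡ _)))) (sym b≈0)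
    ... | no  b≉0 with r , rb≈a ← divide b≉0 a = begin
      a       ≈⟨ rb≈a ⟨
      r * b   ≈⟨ *-congʳ r≈1 ⟩
      1# * b  ≈⟨ *-identityˡ b ⟩
      b       ∎
      where
      r^m≈1 : ∀ m → a ^ m ≈ b ^ m → r ^ m ≈ 1#
      r^m≈1 m a^m≈b^m = *-cancelˡ (^≉0 m b≉0) (begin
        b ^ m * r ^ m  ≈⟨ trans (*-comm _ _) (sym (^-distrib-* r b m)) ⟩
        (r * b) ^ m    ≈⟨ ^-congˡ m rb≈a ⟩
        a ^ m          ≈⟨ a^m≈b^m ⟩
        b ^ m          ≈⟨ *-identityʳ _ ⟨
        b ^ m * 1#     ∎)
      fixed⇒^≈1 : ∀ {x} → x ≉ 0# → σ x ≈ x → x ^ (q ∸ 1) ≈ 1#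
      fixed⇒^≈1 {x} x≉0 σx≈x = *-cancelˡ x≉0 (trans (*x^[n∸1] x q>0) (trans σx≈x (sym (*-identityʳ x))))
      a≉0 : a ≉ 0#
      a≉0 a≈0 = ^≉0 (suc Q) b≉0 (trans (sym eq) (trans (*-congʳ a≈0) (zeroˡ _)))
      r≈1 : r ≈ 1#
      r≈1 = ^-coprime-≈1 (q ∸ 1) (Q ℕ.+ 1) gcd≡1
        (r^m≈1 (q ∸ 1) (trans (fixed⇒^≈1 a≉0 σa≈a) (sym (fixed⇒^≈1 b≉0 σb≈b))))
        (r^m≈1 (Q ℕ.+ 1) (trans (sym (x*x^Q a)) (trans eq (x*x^Q b))))

    1+1≈0 : 1# + 1# ≈ 0#
    1+1≈0 = trans (+-congˡ (sym (+-identityʳ 1#))) (≡.subst (λ m → m · 1# ≈ 0#) (coprime⇒p≡2 k ℓ p-prime gcd≡1) p·1≈0)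

    στ-comm : ∀ x → σ (x ^ Q) ≈ σ x ^ Q
    στ-comm x = trans (^-assocʳ x Q q) (trans (^-congʳ x (ℕ.*-comm Q q)) (sym (^-assocʳ x q Q)))

    open CharTwo (commutativeRing F) 1+1≈0 using (-x≈x)

    normInjectivePair : NormInjectivePair (commutativeRing F) σ (_^ Q)
    normInjectivePair = record
      { σ-endo = frobenius k ; τ-endo = frobenius ℓ ; στ-comm = στ-comm ; norm-injective = norm-injective }

    open Injectivity F ord 1+1≈0 normInjectivePair using (difference-injective)

    f-injective : ∀ {x y} → Γ F q x → Γ F q y → f F q Q x ≈ f F q Q y → x ≈ y
    f-injective {x} {y} x∈Γ y∈Γ fx≈fy = difference-injective (Γ⇒trace≈0 x∈Γ) (Γ⇒trace≈0 y∈Γ)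
      (trans (f≈ x) (trans fx≈fy (sym (f≈ y))))
      where
      f≈ : ∀ x → σ (x * x ^ Q) + x * x ^ Q ≈ f F q Q x
      f≈ x = +-cong (σ.cong (x*x^Q x)) (trans (x*x^Q x) (sym (-x≈x _)))

    coprime⇒permutes : Permutes F (f F q Q) (Γ F q)
    coprime⇒permutes = (λ {x} _ → f∈Γ x) , (λ {x} {y} → f-injective (proj₂ x) (proj₂ y)) , λ (y , y∈Γ) →
      -- Γ is a decidable subset of a finite field, so surjectivity follows from injectivity by
      -- counting.
      let x , x∈Γ , fx≈y = injective-on⇒surjective-on (λ x → _ ≟ 0#) Γ-resp (λ {x} _ → f∈Γ x) f-injective y∈Γ
      in (x , x∈Γ) , λ z≈x → trans (f-cong z≈x) fx≈y

open import Data.Nat.Base using (_+_; _^_; _<_)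

theorem1p6 : ∀ {c ℓ₁ ℓ₂} (p k ℓ : ℕ) → Prime p → 0 < k →
  let q = p ^ k
      Q = p ^ ℓ
  in ((F : HeytingField c ℓ₁ ℓ₂) → HasOrder F (q ^ 3) →
        Permutes F (f F q Q) (Γ F q) ⇔ gcd (q ∸ 1) (Q + 1) ≡ 1)
     × (gcd (q ∸ 1) (Q + 1) ≡ 1 ⇔ (p ≡ 2 × ord₂ k ≤∞ ord₂ ℓ))
theorem1p6 p k ℓ p-prime k>0 =
  (λ F ord → let open Permutation ℓ p-prime k>0 F ord in mk⇔ permutes⇒coprime coprime⇒permutes) ,
  NumberTheory.coprime⇔ord₂≤ k ℓ p-prime k>0
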